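{- For any constant $0<\varepsilon<2/3$, any randomized algorithm that with high probability estimates the metric Steiner Tree cost to within a factor of $(5/3-\varepsilon)$ performs $\Omega(n^2/4^{1/\varepsilon})$ queries in the worst case, and this holds even when the number of terminals $k$ is a constant (depending only on $\varepsilon$).
   Context: An instance of the metric Steiner Tree problem is a triple $(V,T,w)$ where $V$ is a set of $n$ points, $T\subseteq V$ is a set of $k$ terminals, and $w$ is a metric on $V$. A Steiner tree is a tree whose vertices are points of $V$ and which contains all points of $T$; its cost is the sum of $w(u,v)$ over its edges $(u,v)$. ${\mathsf{ST}}(V,T,w)$ denotes the minimum cost of a Steiner tree. An algorithm knows $V$ and $T$ but can access $w$ only through queries: a query specifies a pair $u,v\in V$ and returns $w(u,v)$. The query complexity is the number of queries performed. An algorithm estimates the Steiner Tree cost to within a factor $\alpha\ge 1$ if it outputs a number $X$ with ${\mathsf{ST}}(V,T,w)\le X\le \alpha\cdot{\mathsf{ST}}(V,T,w)$.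
   Formalization: The constant ε, the number X that the algorithm outputs and the probabilities of its random choices are rational rather than real (distances too, which only strengthens the bound); a randomized algorithm is a finite distribution over deterministic adaptive query strategies. -}

module Defs where

open import Data.Nat as ℕ using (ℕ; zero; suc)
open import Data.Fin using (Fin; toℕ) renaming (zero to fzero; suc to fsuc)
open import Data.Bool using (Bool; true; false)
open import Data.Integer using (+_)
open import Data.Rational using (ℚ; 0ℚ; _+_; _*_; _-_; _/_; _≤_; _<_)
open import Data.List using (List; length; map; foldr)
open import Data.List.Membership.Propositional using (_∈_)
open import Data.List.Relation.Unary.Unique.Propositional using (Unique)
open import Data.List.Relation.Unary.All using (All)
open import Data.Product using (Σ; _×_; _,_; proj₁; proj₂; ∃)
open import Data.Sum using (_⊎_)
open import Relation.Binary.PropositionalEquality using (_≡_)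

record Metric (n : ℕ) : Set where
  field
    w        : Fin n → Fin n → ℚ
    nonneg   : ∀ u v → 0ℚ ≤ w u v
    zero-iff : ∀ u v → w u v ≡ 0ℚ → u ≡ v
    w-refl   : ∀ u → w u u ≡ 0ℚ
    symm     : ∀ u v → w u v ≡ w v u
    triangle : ∀ u v x → w u x ≤ w u v + w v x
open Metric public

IsTerminal : {n : ℕ} → ℕ → Fin n → Set
IsTerminal k t = toℕ t ℕ.< k

Edge : ℕ → Set
Edge n = Fin n × Fin n

data Path {n : ℕ} (E : List (Edge n)) : Fin n → Fin n → Set where
  here : ∀ {u} → Path E u u
  step : ∀ {u v x} → ((u , v) ∈ E ⊎ (v , u) ∈ E) → Path E v x → Path E u x

-- A Steiner tree for terminal set T_k: a tree with vertex set `verts ⊆ V`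
-- (a duplicate-free list) and edge list `edges`, which is connected and has
-- |verts| - 1 edges (hence is a tree), and contains every terminal.
record SteinerTree (n k : ℕ) : Set where
  field
    verts      : List (Fin n)
    edges      : List (Edge n)
    uniq       : Unique verts
    edges-in   : All (λ e → proj₁ e ∈ verts × proj₂ e ∈ verts) edges
    size       : length edges ℕ.+ 1 ≡ length verts
    connected  : ∀ u v → u ∈ verts → v ∈ verts → Path edges u v
    terminals  : ∀ t → IsTerminal k t → t ∈ verts
open SteinerTree public

sumℚ : List ℚ → ℚ
sumℚ = foldr _+_ 0ℚ

cost : {n k : ℕ} → Metric n → SteinerTree n k → ℚ
cost M S = sumℚ (map (λ e → w M (proj₁ e) (proj₂ e)) (edges S))

IsSTCost : {n : ℕ} → ℕ → Metric n → ℚ → Set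
IsSTCost {n} k M c = (Σ (SteinerTree n k) λ S → cost M S ≡ c)
                   × (∀ (S : SteinerTree n k) → c ≤ cost M S)

Estimates : {n : ℕ} → ℕ → Metric n → ℚ → ℚ → Set
Estimates k M α X = ∃ λ c → IsSTCost k M c × (c ≤ X × X ≤ α * c)

data QTree (n : ℕ) : Set where
  output : ℚ → QTree n
  query  : Fin n → Fin n → (ℚ → QTree n) → QTree n

run : {n : ℕ} → QTree n → Metric n → ℚ
run (output x)    M = x
run (query u v f) M = run (f (w M u v)) M

numQueries : {n : ℕ} → QTree n → Metric n → ℕ
numQueries (output x)    M = 0
numQueries (query u v f) M = suc (numQueries (f (w M u v)) M)

sumFin : (m : ℕ) → (Fin m → ℚ) → ℚ
sumFin zero    f = 0ℚ
sumFin (suc m) f = f fzero + sumFin m (λ i → f (fsuc i))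

record RandAlg (n : ℕ) : Set where
  field
    seeds   : ℕ
    prob    : Fin seeds → ℚ
    prob≥0  : ∀ i → 0ℚ ≤ prob i
    prob-1  : sumFin seeds prob ≡ + 1 / 1
    alg     : Fin seeds → QTree n
open RandAlg public

SucceedsWithProb : {n : ℕ} → ℕ → ℚ → ℚ → RandAlg n → Metric n → Set
SucceedsWithProb k α p A M =
  Σ (Fin (seeds A) → Bool) λ good →
      (∀ i → good i ≡ true → Estimates k M α (run (alg A i) M))
    × (p ≤ sumFin (seeds A) (λ i → if′ good i then prob A i else 0ℚ))
  where
    if′_then_else_ : Bool → ℚ → ℚ → ℚ
    if′ true  then x else y = x
    if′ false then x else y = y

EstimatesWHP : {n : ℕ} → ℕ → ℚ → RandAlg n → Set
EstimatesWHP {n} k α A = ∀ (M : Metric n) → SucceedsWithProb k α (+ 2 / 3) A M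

{-# OPTIONS --safe #-}

-- The terminals are the leaves of a binary tree of height H + 1, H = ⌊1/ε⌋, and every inner node g other than the
-- root owns a group of about n/2^(H+1) Steiner points whose distances to the terminals are the tree distances.
-- In M₀ two Steiner points are only connected through terminals. In M s one random point of each group is
-- planted, and planted points are at tree distance of each other, so the whole tree becomes a Steiner tree, of
-- cost 3(H+1)2^H. In M₀ a Steiner tree is a union of stars of terminals; replacing each star by a spanning tree
-- of its terminals under a cheaper ultrametric yields a spanning tree of all terminals, so its cost is at least
-- (5H+2)2^H, which is 5/3 − 1/(H+1) times as much. To tell M₀ from M s a seed must query a planted pair while run
-- on M₀; a given pair is planted with probability at most 1/m², m being the group size, so some seed makes at
-- least m²/3 queries.
module Submission where

open import Defs
open import Data.Nat using (ℕ; suc; _+_; _*_; _^_; _≤_; _<_)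
open import Data.Fin using (Fin)
open import Data.Integer using (+_)
open import Data.Rational using (ℚ; 0ℚ; _-_; _/_)
open import Data.Product using (Σ; _×_; ∃)

import Algebra.Properties.CommutativeSemigroup
open import Algebra.Bundles using (CommutativeMonoid)
open import Data.Bool using (Bool; true; false; _∧_; if_then_else_)
open import Data.Bool.Properties using (∧-comm)
open import Data.Empty using (⊥; ⊥-elim)
import Data.Fin as Fin
import Data.Fin.Properties as Fin
import Data.Integer as ℤ
import Data.Integer.Properties as ℤ
open import Data.List using (List; []; _∷_; _++_; map; length; filter; applyUpTo; allFin)
open import Data.List.Properties
  using (filter-all; filter-accept; filter-reject; length-applyUpTo; applyUpTo-∷ʳ; map-applyUpTo; map-++; ++-identityʳ; ++-assoc)
open import Data.List.Membership.Propositional using (_∈_)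
open import Data.List.Membership.Propositional.Properties using (∈-filter⁻; ∈-applyUpTo⁺; ∈-applyUpTo⁻; ∈-allFin)
open import Data.List.Relation.Binary.Permutation.Propositional using (_↭_; ↭-refl; ↭-trans; prep)
open import Data.List.Relation.Binary.Permutation.Propositional.Properties using (shift; All-resp-↭; map⁺; ++⁺)
open import Data.List.Relation.Unary.All as All using (All; []; _∷_)
import Data.List.Relation.Unary.All.Properties as All
open import Data.List.Relation.Unary.AllPairs using (AllPairs; []; _∷_)
import Data.List.Relation.Unary.AllPairs.Properties as AllPairs
open import Data.List.Relation.Unary.Any using (here; there)
open import Data.List.Relation.Unary.Unique.Propositional using (Unique)
open import Data.List.Relation.Unary.Unique.Propositional.Properties using (allFin⁺)
open import Data.Nat using (zero; _∸_; _⊔_; _⊓_; ⌊_/2⌋; z≤n; s≤s; _≟_; _≤?_; _<?_; NonZero; >-nonZero)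
import Data.Nat.DivMod as ND
open import Data.Nat.Divisibility using (divides)
open import Data.Nat.ListAction using (sum)
open import Data.Nat.ListAction.Properties using (sum-++; sum-↭)
open import Data.Nat.Logarithm using (⌊log₂_⌋; ⌊log₂⌋-mono-≤; ⌊log₂⌊n/2⌋⌋≡⌊log₂n⌋∸1; ⌊log₂[2^n]⌋≡n)
open import Data.Nat.Properties
open import Data.Nat.Tactic.RingSolver using (solve-∀)
open import Data.Product using (_,_; proj₁; proj₂; ∃-syntax)
import Data.Rational as ℚ
import Data.Rational.Properties as ℚ
import Data.Rational.Unnormalised as ℚᵘ
import Data.Rational.Unnormalised.Properties as ℚᵘ
open import Data.Sum using (_⊎_; inj₁; inj₂; [_,_]′)
open import Relation.Binary.Definitions using (tri<; tri≈; tri>)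
open import Relation.Binary.PropositionalEquality
  using (_≡_; _≢_; refl; sym; trans; cong; cong₂; subst; subst₂; module ≡-Reasoning)
open import Relation.Nullary using (Dec; yes; no)
open import Relation.Nullary.Decidable using (¬?; does; dec-true; dec-false; _×-dec_)


-- Replacing a star is a matter of accounts. Let its centre have height j. A terminal below the
-- centre offers its distance radius j, one that meets the centre at height i > j offers 2 radius i
-- - radius j. In the tight case there is one terminal under each child of the centre and one under
-- its sibling: the offer radius j + 2 radius (j + 1) has to pay for links at heights j and j + 1,
-- that is, dual j + dual (j + 1). With lengths doubling from height to height this reads d + 2d = r
-- + 4r, so d = 5r/3. As the number of subtrees halves meanwhile, every middle level weighs the
-- same: 3·2^H in the hidden tree, 5·2^H in the lower bound. Only the ends of the tree lose, and
-- they are tuned: the pattern 3·2^(i-1), 5·2^(i-1) is replaced by 2, 4 at height 1 and by 2^(H+1),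
-- 3·2^H at the top. The bound on spanning trees comes from cuts: at least 2^(N-i) - 1 links join
-- different subtrees of height i, and each of them is charged dual (i + 1) - dual i for that
-- height.

-- Halving, and the height at which two leaves of a binary tree meet

halve : ℕ → ℕ → ℕ
halve zero    x = x
halve (suc i) x = ⌊ halve i x /2⌋

halve-⌊/2⌋ : ∀ i x → halve i ⌊ x /2⌋ ≡ halve (suc i) x
halve-⌊/2⌋ zero    x = refl
halve-⌊/2⌋ (suc i) x = cong ⌊_/2⌋ (halve-⌊/2⌋ i x)

halve-+ : ∀ i j x → halve (i + j) x ≡ halve i (halve j x)
halve-+ zero    j x = refl
halve-+ (suc i) j x = cong ⌊_/2⌋ (halve-+ i j x)

⌊2*n/2⌋≡n : ∀ n → ⌊ 2 * n /2⌋ ≡ n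
⌊2*n/2⌋≡n n = trans (cong (λ z → ⌊ n + z /2⌋) (+-identityʳ n)) (sym (n≡⌊n+n/2⌋ n))

2*⌊n/2⌋≤n : ∀ n → 2 * ⌊ n /2⌋ ≤ n
2*⌊n/2⌋≤n zero          = z≤n
2*⌊n/2⌋≤n (suc zero)    = z≤n
2*⌊n/2⌋≤n (suc (suc n)) = subst (_≤ suc (suc n)) (sym (*-suc 2 ⌊ n /2⌋)) (s≤s (s≤s (2*⌊n/2⌋≤n n)))

halve-*2^ : ∀ i g → halve i (g * 2 ^ i) ≡ g
halve-*2^ zero    g = *-identityʳ g
halve-*2^ (suc i) g = begin
  ⌊ halve i (g * (2 * 2 ^ i)) /2⌋ ≡⟨ cong (λ z → ⌊ halve i z /2⌋) (sym (*-assoc g 2 (2 ^ i))) ⟩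
  ⌊ halve i (g * 2 * 2 ^ i) /2⌋   ≡⟨ cong ⌊_/2⌋ (halve-*2^ i (g * 2)) ⟩
  ⌊ g * 2 /2⌋                     ≡⟨ cong ⌊_/2⌋ (*-comm g 2) ⟩
  ⌊ 2 * g /2⌋                     ≡⟨ ⌊2*n/2⌋≡n g ⟩
  g                               ∎
  where open ≡-Reasoning

halve*2^≤ : ∀ i x → halve i x * 2 ^ i ≤ x
halve*2^≤ zero    x = ≤-reflexive (*-identityʳ x)
halve*2^≤ (suc i) x = begin
  ⌊ halve i x /2⌋ * (2 * 2 ^ i) ≡⟨ sym (*-assoc ⌊ halve i x /2⌋ 2 (2 ^ i)) ⟩
  ⌊ halve i x /2⌋ * 2 * 2 ^ i   ≡⟨ cong (_* 2 ^ i) (*-comm ⌊ halve i x /2⌋ 2) ⟩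
  2 * ⌊ halve i x /2⌋ * 2 ^ i   ≤⟨ *-monoˡ-≤ (2 ^ i) (2*⌊n/2⌋≤n (halve i x)) ⟩
  halve i x * 2 ^ i             ≤⟨ halve*2^≤ i x ⟩
  x                             ∎
  where open ≤-Reasoning

halve-cong-≤ : ∀ {i j} x y → i ≤ j → halve i x ≡ halve i y → halve j x ≡ halve j y
halve-cong-≤ {i} {j} x y i≤j eq with j ∸ i in e
... | d = subst (λ z → halve z x ≡ halve z y) (trans (cong (_+ i) (sym e)) (m∸n+n≡m i≤j))
            (trans (halve-+ d i x) (trans (cong (halve d) eq) (sym (halve-+ d i y))))

-- A node has only two children.
⌊/2⌋-pigeonhole : ∀ a b c → ⌊ a /2⌋ ≡ ⌊ b /2⌋ → ⌊ a /2⌋ ≡ ⌊ c /2⌋ → a ≢ b → a ≢ c → b ≡ c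
⌊/2⌋-pigeonhole zero zero c _ _ p _ = ⊥-elim (p refl)
⌊/2⌋-pigeonhole zero (suc zero) zero _ _ _ q = ⊥-elim (q refl)
⌊/2⌋-pigeonhole zero (suc zero) (suc zero) _ _ _ _ = refl
⌊/2⌋-pigeonhole (suc zero) zero zero _ _ _ _ = refl
⌊/2⌋-pigeonhole (suc zero) zero (suc zero) _ _ _ q = ⊥-elim (q refl)
⌊/2⌋-pigeonhole (suc zero) (suc zero) c _ _ p _ = ⊥-elim (p refl)
⌊/2⌋-pigeonhole (suc (suc a)) (suc (suc b)) (suc (suc c)) e₁ e₂ p q =
  cong (λ z → suc (suc z)) (⌊/2⌋-pigeonhole a b c (suc-injective e₁) (suc-injective e₂)
    (λ e → p (cong (λ z → suc (suc z)) e)) (λ e → q (cong (λ z → suc (suc z)) e)))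

opaque
  -- Least i ≤ N such that x and y agree after i halvings (N if there is none).
  lev : ℕ → ℕ → ℕ → ℕ
  lev zero    x y = 0
  lev (suc N) x y with halve N x ≟ halve N y
  ... | yes _ = lev N x y
  ... | no  _ = suc N

  lev≤ : ∀ N x y → lev N x y ≤ N
  lev≤ zero    x y = z≤n
  lev≤ (suc N) x y with halve N x ≟ halve N y
  ... | yes _ = m≤n⇒m≤1+n (lev≤ N x y)
  ... | no  _ = ≤-refl

  lev-sound< : ∀ N x y i → i < N → lev N x y ≤ i → halve i x ≡ halve i y
  lev-sound< (suc N) x y i i<N le with halve N x ≟ halve N y
  ... | no  _ = ⊥-elim (<⇒≱ i<N le)
  ... | yes e with i <? N
  ...   | yes q = lev-sound< N x y i q le
  ...   | no ¬q = halve-cong-≤ {N} {i} x y (≮⇒≥ ¬q) e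

  -- `lev` takes the value `N` also when nothing below agrees, so from height `N` on agreement has
  -- to come from the hypothesis on `halve N`. Leaves of one tree satisfy it, their common ancestor
  -- being the root.
  lev-sound : ∀ N x y i → halve N x ≡ halve N y → lev N x y ≤ i → halve i x ≡ halve i y
  lev-sound N x y i eq le with i <? N
  ... | yes q = lev-sound< N x y i q le
  ... | no ¬q = halve-cong-≤ {N} {i} x y (≮⇒≥ ¬q) eq

  lev-least : ∀ N x y i → halve i x ≡ halve i y → lev N x y ≤ i
  lev-least zero    x y i eq = z≤n
  lev-least (suc N) x y i eq with halve N x ≟ halve N y
  ... | yes _ = lev-least N x y i eq
  ... | no ne with suc N ≤? i
  ...   | yes p = p
  ...   | no ¬p = ⊥-elim (ne (halve-cong-≤ {i} {N} x y (≤-pred (≰⇒> ¬p)) eq))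

  lev-refl : ∀ N x → lev N x x ≡ 0
  lev-refl N x = n≤0⇒n≡0 (lev-least N x x 0 refl)

  lev-sym : ∀ N x y → lev N x y ≡ lev N y x
  lev-sym zero    x y = refl
  lev-sym (suc N) x y with halve N x ≟ halve N y | halve N y ≟ halve N x
  ... | yes _ | yes _ = lev-sym N x y
  ... | yes e | no ne = ⊥-elim (ne (sym e))
  ... | no ne | yes e = ⊥-elim (ne (sym e))
  ... | no _  | no _  = refl

  lev-ultra : ∀ N x y z → lev N x z ≤ lev N x y ⊔ lev N y z
  lev-ultra zero    x y z = z≤n
  lev-ultra (suc N) x y z with halve N x ≟ halve N z | halve N x ≟ halve N y | halve N y ≟ halve N z
  ... | yes _  | yes _ | yes _ = lev-ultra N x y z
  ... | yes _  | yes _ | no  _ = m≤n⇒m≤o⊔n (lev N x y) (m≤n⇒m≤1+n (lev≤ N x z))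
  ... | yes _  | no  _ | yes _ = m≤n⇒m≤n⊔o (lev N y z) (m≤n⇒m≤1+n (lev≤ N x z))
  ... | yes _  | no  _ | no  _ = m≤n⇒m≤n⊔o (suc N) (m≤n⇒m≤1+n (lev≤ N x z))
  ... | no ne  | yes a | yes b = ⊥-elim (ne (trans a b))
  ... | no _   | yes _ | no  _ = m≤n⊔m (lev N x y) (suc N)
  ... | no _   | no  _ | yes _ = m≤m⊔n (suc N) (lev N y z)
  ... | no _   | no  _ | no  _ = m≤m⊔n (suc N) (suc N)

  -- Leaves that part from `x` below the same ancestor all lie under its one other child, so they
  -- meet each other one level lower. Links among them are therefore cheaper than their distance
  -- from `x` suggests.
  lev-binary : ∀ N x y z i → halve N x ≡ halve N y → halve N x ≡ halve N z →
               lev N x y ≡ suc i → lev N x z ≡ suc i → lev N y z ≤ i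
  lev-binary N x y z i ey ez ly lz = lev-least N y z i
    (⌊/2⌋-pigeonhole (halve i x) (halve i y) (halve i z)
      (lev-sound N x y (suc i) ey (≤-reflexive ly)) (lev-sound N x z (suc i) ez (≤-reflexive lz))
      (λ e → <⇒≱ (n<1+n i) (subst (_≤ i) ly (lev-least N x y i e)))
      (λ e → <⇒≱ (n<1+n i) (subst (_≤ i) lz (lev-least N x z i e))))

-- Lengths of the hidden tree and prices of the lower bound

≤-by : ∀ {m o} n → m + n ≡ o → m ≤ o
≤-by {m} n refl = m≤m+n m n

suc-mono⇒mono : (g : ℕ → ℕ) → (∀ i → g i ≤ g (suc i)) → ∀ {i j} → i ≤ j → g i ≤ g j
suc-mono⇒mono g s {i} {zero}  z≤n = ≤-refl
suc-mono⇒mono g s {i} {suc j} le with m≤n⇒m<n∨m≡n le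
... | inj₁ (s≤s p) = ≤-trans (suc-mono⇒mono g s p) (s j)
... | inj₂ refl    = ≤-refl

-- radius i is the distance from a node of height i of the hidden tree to the leaves below it,
-- dual i the price of merging two subtrees of height i − 1 in the lower bound;
-- Radius and Dual override the value at the top height h + 2.
radius : ℕ → ℕ
radius 0             = 0
radius 1             = 2
radius (suc (suc i)) = 6 * 2 ^ i

dual : ℕ → ℕ
dual 0             = 0
dual 1             = 4
dual (suc (suc i)) = 10 * 2 ^ i

radius< : ∀ i → radius i < radius (suc i)
radius< 0 = s≤s z≤n
radius< 1 = s≤s (s≤s (s≤s z≤n))
radius< (suc (suc i)) = *-monoʳ-< 6 (subst (_< 2 * 2 ^ i) (+-identityʳ (2 ^ i))
  (+-monoʳ-< (2 ^ i) (subst (0 <_) (sym (+-identityʳ (2 ^ i))) (m^n>0 2 i))))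

radius-mono : ∀ {i j} → i ≤ j → radius i ≤ radius j
radius-mono = suc-mono⇒mono radius (λ i → <⇒≤ (radius< i))

radius≤2* : ∀ i → radius i ≤ 2 * 2 ^ i
radius≤2* 0 = z≤n
radius≤2* 1 = s≤s (s≤s z≤n)
radius≤2* (suc (suc i)) = ≤-by (2 * 2 ^ i) (e (2 ^ i))
  where
  e : ∀ p → 6 * p + 2 * p ≡ 2 * (2 * (2 * p))
  e = solve-∀

dual≤radius-suc : ∀ i → dual i ≤ radius (suc i)
dual≤radius-suc 0 = z≤n
dual≤radius-suc 1 = s≤s (s≤s (s≤s (s≤s z≤n)))
dual≤radius-suc (suc (suc i)) = ≤-by (2 * 2 ^ i) (e (2 ^ i))
  where
  e : ∀ p → 10 * p + 2 * p ≡ 6 * (2 * p)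
  e = solve-∀

dual≤2radius : ∀ i → dual i ≤ 2 * radius i
dual≤2radius 0 = z≤n
dual≤2radius 1 = ≤-refl
dual≤2radius (suc (suc i)) = ≤-by (2 * 2 ^ i) (e (2 ^ i))
  where
  e : ∀ p → 10 * p + 2 * p ≡ 2 * (6 * p)
  e = solve-∀

dual-mono : ∀ {i j} → i ≤ j → dual i ≤ dual j
dual-mono = suc-mono⇒mono dual s
  where
  e : ∀ p → 10 * p + 10 * p ≡ 10 * (2 * p)
  e = solve-∀
  s : ∀ i → dual i ≤ dual (suc i)
  s 0 = z≤n
  s 1 = s≤s (s≤s (s≤s (s≤s z≤n)))
  s (suc (suc i)) = ≤-by (10 * 2 ^ i) (e (2 ^ i))

dual-pair : ∀ i → dual (suc i) + dual (suc (suc i)) ≤ radius (suc i) + 2 * radius (suc (suc i))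
dual-pair 0 = ≤-refl
dual-pair (suc i) = ≤-reflexive (e (2 ^ i))
  where
  e : ∀ p → 10 * p + 10 * (2 * p) ≡ 6 * p + 2 * (6 * (2 * p))
  e = solve-∀

dual-next : ∀ i → dual i + radius i ≤ 2 * radius (suc i)
dual-next 0 = z≤n
dual-next 1 = ≤-by 6 refl
dual-next (suc (suc i)) = ≤-by (8 * 2 ^ i) (e (2 ^ i))
  where
  e : ∀ p → 10 * p + 6 * p + 8 * p ≡ 2 * (6 * (2 * p))
  e = solve-∀

dual-far : ∀ i → dual (suc (suc i)) + radius i ≤ 2 * radius (suc (suc i))
dual-far i = ≤-trans (+-monoʳ-≤ (10 * 2 ^ i) (radius≤2* i)) (≤-reflexive (e (2 ^ i)))
  where
  e : ∀ p → 10 * p + 2 * p ≡ 2 * (6 * p)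
  e = solve-∀

radius<top : ∀ h → radius (suc h) < 2 ^ suc (suc h)
radius<top 0 = s≤s (s≤s (s≤s z≤n))
radius<top (suc h) = subst (radius (suc (suc h)) <_) (e (2 ^ h))
  (m<m+n (6 * 2 ^ h) {2 * 2 ^ h} (*-mono-≤ (s≤s {0} {1} z≤n) (m^n>0 2 h)))
  where
  e : ∀ p → 6 * p + 2 * p ≡ 2 * (2 * (2 * p))
  e = solve-∀

dual≤top : ∀ h → dual (suc h) ≤ 3 * 2 ^ suc h
dual≤top 0 = ≤-by 2 refl
dual≤top (suc h) = ≤-by (2 * 2 ^ h) (e (2 ^ h))
  where
  e : ∀ p → 10 * p + 2 * p ≡ 3 * (2 * (2 * p))
  e = solve-∀

dual-pair-top : ∀ h → dual (suc h) + 3 * 2 ^ suc h ≤ radius (suc h) + 2 * 2 ^ suc (suc h)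
dual-pair-top 0 = ≤-refl
dual-pair-top (suc h) = ≤-reflexive (e (2 ^ h))
  where
  e : ∀ p → 10 * p + 3 * (2 * (2 * p)) ≡ 6 * p + 2 * (2 * (2 * (2 * p)))
  e = solve-∀

dual-next-top : ∀ h → dual (suc h) + radius (suc h) ≤ 2 * 2 ^ suc (suc h)
dual-next-top 0 = ≤-by 2 refl
dual-next-top (suc h) = ≤-reflexive (e (2 ^ h))
  where
  e : ∀ p → 10 * p + 6 * p ≡ 2 * (2 * (2 * (2 * p)))
  e = solve-∀

dual-far-top : ∀ h → 3 * 2 ^ suc h + radius h ≤ 2 * 2 ^ suc (suc h)
dual-far-top h = ≤-trans (+-monoʳ-≤ (3 * 2 ^ suc h) (radius≤2* h)) (≤-reflexive (e (2 ^ h)))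
  where
  e : ∀ p → 3 * (2 * p) + 2 * p ≡ 2 * (2 * (2 * p))
  e = solve-∀

module Heights (h : ℕ) where

  H N : ℕ
  H = suc h
  N = suc H

  opaque
    Radius : ℕ → ℕ
    Radius i with i ≤? H
    ... | yes _ = radius i
    ... | no  _ = 2 ^ N

    Dual : ℕ → ℕ
    Dual i with i ≤? H
    ... | yes _ = dual i
    ... | no  _ = 3 * 2 ^ H

    Radius-low : ∀ {i} → i ≤ H → Radius i ≡ radius i
    Radius-low {i} p with i ≤? H
    ... | yes _ = refl
    ... | no ¬p = ⊥-elim (¬p p)

    Radius-top : ∀ {i} → H < i → Radius i ≡ 2 ^ N
    Radius-top {i} p with i ≤? H
    ... | yes q = ⊥-elim (<⇒≱ p q)
    ... | no _  = refl

    Dual-low : ∀ {i} → i ≤ H → Dual i ≡ dual i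
    Dual-low {i} p with i ≤? H
    ... | yes _ = refl
    ... | no ¬p = ⊥-elim (¬p p)

    Dual-top : ∀ {i} → H < i → Dual i ≡ 3 * 2 ^ H
    Dual-top {i} p with i ≤? H
    ... | yes q = ⊥-elim (<⇒≱ p q)
    ... | no _  = refl

    Radius-< : ∀ {i j} → i < j → j ≤ N → Radius i < Radius j
    Radius-< {i} {j} p q with i ≤? H | j ≤? H
    ... | yes _ | yes _ = ≤-trans (radius< i) (radius-mono p)
    ... | yes a | no  _ = ≤-<-trans (radius-mono a) (radius<top h)
    ... | no  a | _     = ⊥-elim (a (≤-pred (≤-trans p q)))

    Radius-mono : ∀ {i j} → i ≤ j → Radius i ≤ Radius j
    Radius-mono {i} {j} p with i ≤? H | j ≤? H
    ... | yes _ | yes _ = radius-mono p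
    ... | yes a | no  _ = ≤-trans (radius-mono a) (<⇒≤ (radius<top h))
    ... | no  a | yes b = ⊥-elim (a (≤-trans p b))
    ... | no  _ | no  _ = ≤-refl

    Dual-mono : ∀ {i j} → i ≤ j → Dual i ≤ Dual j
    Dual-mono {i} {j} p with i ≤? H | j ≤? H
    ... | yes _ | yes _ = dual-mono p
    ... | yes a | no  _ = ≤-trans (dual-mono a) (dual≤top h)
    ... | no  a | yes b = ⊥-elim (a (≤-trans p b))
    ... | no  _ | no  _ = ≤-refl

    -- Pays for links within one child subtree of the centre: each terminal there offers the radius
    -- of the centre, while two of them meet below it.
    Dual≤Radius-suc : ∀ {i} → suc i ≤ H → Dual i ≤ Radius (suc i)
    Dual≤Radius-suc {i} p rewrite Radius-low p | Dual-low (<⇒≤ p) = dual≤radius-suc i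

    Dual≤2Radius : ∀ i → Dual i ≤ 2 * Radius i
    Dual≤2Radius i with i ≤? H
    ... | yes _ = dual≤2radius i
    ... | no  _ = ≤-by (2 ^ H) (e (2 ^ H))
      where
      e : ∀ p → 3 * p + p ≡ 2 * (2 * p)
      e = solve-∀

    -- Tight for every j: this is where the ratio 5/3 comes from.
    Dual-pair : ∀ {j} → 1 ≤ j → j ≤ H → Dual j + Dual (suc j) ≤ Radius j + 2 * Radius (suc j)
    Dual-pair {suc j} _ p with suc (suc j) ≤? H
    ... | yes q rewrite Radius-low p | Dual-low p = dual-pair j
    ... | no ¬q with ≤-antisym p (≤-pred (≰⇒> ¬q))
    ...   | refl rewrite Radius-low p | Dual-low p = dual-pair-top h

    -- Pays for links among terminals under the sibling of a centre of height `j`: they meet at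
    -- height `j` at most, and each offers twice the next radius less the centre's own.
    Dual-next : ∀ {j} → j ≤ H → Dual j + Radius j ≤ 2 * Radius (suc j)
    Dual-next {j} p with suc j ≤? H
    ... | yes q rewrite Radius-low p | Dual-low p = dual-next j
    ... | no ¬q with ≤-antisym p (≤-pred (≰⇒> ¬q))
    ...   | refl rewrite Radius-low p | Dual-low p = dual-next-top h

    -- Pays for a link to a terminal that meets the centre two or more heights above it.
    Dual-far : ∀ {i j} → suc (suc j) ≤ i → i ≤ N → Dual i + Radius j ≤ 2 * Radius i
    Dual-far {suc (suc i)} {j} (s≤s (s≤s p)) q = ≤-trans (+-monoʳ-≤ (Dual (suc (suc i))) (Radius-mono p)) base
      where
      i≤h : i ≤ h
      i≤h = ≤-pred (≤-pred q)
      base : Dual (suc (suc i)) + Radius i ≤ 2 * Radius (suc (suc i))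
      base with suc (suc i) ≤? H
      ... | yes _ rewrite Radius-low (m≤n⇒m≤1+n i≤h) = dual-far i
      ... | no ¬r with ≤-antisym i≤h (≤-pred (≤-pred (≰⇒> ¬r)))
      ...   | refl rewrite Radius-low (m≤n⇒m≤1+n i≤h) = dual-far-top h

-- Natural numbers as rationals, and integral metrics

opaque
  ⟦_⟧ : ℕ → ℚ
  ⟦ n ⟧ = + n / 1

  toℚᵘ-⟦⟧ : ∀ n → ℚ.toℚᵘ ⟦ n ⟧ ℚᵘ.≃ ℚᵘ.mkℚᵘ (+ n) 0
  toℚᵘ-⟦⟧ n = ℚ.toℚᵘ-fromℚᵘ (ℚᵘ.mkℚᵘ (+ n) 0)

  ⟦⟧-+ : ∀ m n → ⟦ m + n ⟧ ≡ ⟦ m ⟧ ℚ.+ ⟦ n ⟧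
  ⟦⟧-+ m n = ℚ.toℚᵘ-injective (ℚᵘ.≃-trans (toℚᵘ-⟦⟧ (m + n)) (ℚᵘ.≃-trans (ℚᵘ.*≡* e)
    (ℚᵘ.≃-sym (ℚᵘ.≃-trans (ℚ.toℚᵘ-homo-+ ⟦ m ⟧ ⟦ n ⟧) (ℚᵘ.+-cong (toℚᵘ-⟦⟧ m) (toℚᵘ-⟦⟧ n))))))
    where
    e : + (m + n) ℤ.* + 1 ≡ (+ m ℤ.* + 1 ℤ.+ + n ℤ.* + 1) ℤ.* + 1
    e = cong (λ z → z ℤ.* + 1) (cong₂ ℤ._+_ (sym (ℤ.*-identityʳ (+ m))) (sym (ℤ.*-identityʳ (+ n))))

  ⟦⟧-* : ∀ m n → ⟦ m * n ⟧ ≡ ⟦ m ⟧ ℚ.* ⟦ n ⟧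
  ⟦⟧-* m n = ℚ.toℚᵘ-injective (ℚᵘ.≃-trans (toℚᵘ-⟦⟧ (m * n)) (ℚᵘ.≃-trans (ℚᵘ.*≡* (cong (λ z → z ℤ.* + 1) (ℤ.pos-* m n)))
    (ℚᵘ.≃-sym (ℚᵘ.≃-trans (ℚ.toℚᵘ-homo-* ⟦ m ⟧ ⟦ n ⟧) (ℚᵘ.*-cong (toℚᵘ-⟦⟧ m) (toℚᵘ-⟦⟧ n))))))

  ⟦⟧-mono : ∀ {m n} → m ≤ n → ⟦ m ⟧ ℚ.≤ ⟦ n ⟧
  ⟦⟧-mono {m} {n} p = ℚ.toℚᵘ-cancel-≤ (ℚᵘ.≤-respˡ-≃ (ℚᵘ.≃-sym (toℚᵘ-⟦⟧ m)) (ℚᵘ.≤-respʳ-≃ (ℚᵘ.≃-sym (toℚᵘ-⟦⟧ n))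
    (ℚᵘ.*≤* (ℤ.*-monoʳ-≤-nonNeg (+ 1) (ℤ.+≤+ p)))))

  ⟦⟧-cancel : ∀ {m n} → ⟦ m ⟧ ℚ.≤ ⟦ n ⟧ → m ≤ n
  ⟦⟧-cancel {m} {n} p with ℚᵘ.≤-respˡ-≃ (toℚᵘ-⟦⟧ m) (ℚᵘ.≤-respʳ-≃ (toℚᵘ-⟦⟧ n) (ℚ.toℚᵘ-mono-≤ p))
  ... | ℚᵘ.*≤* q = ℤ.drop‿+≤+ (ℤ.*-cancelʳ-≤-pos (+ m) (+ n) (+ 1) q)

  ⟦⟧-mono-< : ∀ {m n} → m < n → ⟦ m ⟧ ℚ.< ⟦ n ⟧
  ⟦⟧-mono-< {m} {n} p with ⟦ m ⟧ ℚ.<? ⟦ n ⟧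
  ... | yes q = q
  ... | no ¬q = ⊥-elim (<⇒≱ p (⟦⟧-cancel (ℚ.≮⇒≥ ¬q)))

  ⟦0⟧≡0ℚ : ⟦ 0 ⟧ ≡ 0ℚ
  ⟦0⟧≡0ℚ = refl

  ⟦1⟧≡1ℚ : ⟦ 1 ⟧ ≡ ℚ.1ℚ
  ⟦1⟧≡1ℚ = refl

  ⟦⟧≡0 : ∀ {n} → ⟦ n ⟧ ≡ 0ℚ → n ≡ 0
  ⟦⟧≡0 {n} e = n≤0⇒n≡0 (⟦⟧-cancel (ℚ.≤-reflexive e))

natMetric : ∀ {n} (d : Fin n → Fin n → ℕ) → (∀ u v → d u v ≡ 0 → u ≡ v) → (∀ u → d u u ≡ 0) →
            (∀ u v → d u v ≡ d v u) → (∀ u v x → d u x ≤ d u v + d v x) → Metric n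
natMetric d d≡0 d-refl d-sym d-tri = record
  { w        = λ u v → ⟦ d u v ⟧
  ; nonneg   = λ u v → subst (ℚ._≤ ⟦ d u v ⟧) ⟦0⟧≡0ℚ (⟦⟧-mono z≤n)
  ; zero-iff = λ u v e → d≡0 u v (⟦⟧≡0 e)
  ; w-refl   = λ u → trans (cong ⟦_⟧ (d-refl u)) ⟦0⟧≡0ℚ
  ; symm     = λ u v → cong ⟦_⟧ (d-sym u v)
  ; triangle = λ u v x → subst (⟦ d u x ⟧ ℚ.≤_) (⟦⟧-+ (d u v) (d v x)) (⟦⟧-mono (d-tri u v x))
  }

-- Metrics from tree positions, with and without planted points

dichotomy : ∀ b → b ≡ true ⊎ b ≡ false
dichotomy true  = inj₁ refl
dichotomy false = inj₂ refl

module Points (h : ℕ) {n : ℕ} (pos ht : Fin n → ℕ) where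
  open Heights h

  rad : Fin n → ℕ
  rad v = Radius (ht v)

  -- Height of the lowest common ancestor. Positions are leaves below the nodes, so their level
  -- alone is too low when one node lies above the other; the two heights correct this.
  join : Fin n → Fin n → ℕ
  join u v = ht u ⊔ ht v ⊔ lev N (pos u) (pos v)

  U : Fin n → Fin n → ℕ
  U u v = Radius (join u v)

  join-sym : ∀ u v → join u v ≡ join v u
  join-sym u v = cong₂ _⊔_ (⊔-comm (ht u) (ht v)) (lev-sym N (pos u) (pos v))

  U-sym : ∀ u v → U u v ≡ U v u
  U-sym u v = cong Radius (join-sym u v)

  ht≤joinˡ : ∀ u v → ht u ≤ join u v
  ht≤joinˡ u v = ≤-trans (m≤m⊔n (ht u) (ht v)) (m≤m⊔n _ (lev N (pos u) (pos v)))

  ht≤joinʳ : ∀ u v → ht v ≤ join u v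
  ht≤joinʳ u v = ≤-trans (m≤n⊔m (ht u) (ht v)) (m≤m⊔n _ (lev N (pos u) (pos v)))

  lev≤join : ∀ u v → lev N (pos u) (pos v) ≤ join u v
  lev≤join u v = m≤n⊔m (ht u ⊔ ht v) _

  rad≤Uˡ : ∀ u v → rad u ≤ U u v
  rad≤Uˡ u v = Radius-mono (ht≤joinˡ u v)

  rad≤Uʳ : ∀ u v → rad v ≤ U u v
  rad≤Uʳ u v = Radius-mono (ht≤joinʳ u v)

  U-ultra : ∀ u v x → U u x ≤ U u v ⊔ U v x
  U-ultra u v x = ≤-trans (Radius-mono join-ultra)
    (≤-reflexive (mono-≤-distrib-⊔ {Radius} Radius-mono (join u v) (join v x)))
    where
    join-ultra : join u x ≤ join u v ⊔ join v x
    join-ultra = ⊔-lub (⊔-lub (m≤n⇒m≤n⊔o (join v x) (ht≤joinˡ u v)) (m≤n⇒m≤o⊔n (join u v) (ht≤joinʳ v x)))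
      (≤-trans (lev-ultra N (pos u) (pos v) (pos x)) (⊔-mono-≤ (lev≤join u v) (lev≤join v x)))

  detour : (Fin n → Bool) → Fin n → Fin n → ℕ
  detour P u v = if P u ∧ P v then 0 else rad u ⊓ rad v

  detour≤ : ∀ P u v → detour P u v ≤ rad u ⊓ rad v
  detour≤ P u v with P u ∧ P v
  ... | true  = z≤n
  ... | false = ≤-refl

  -- 2U − rad u − rad v is the distance in the hidden tree. Unless both endpoints are planted (P),
  -- the path has to detour through a terminal below the lower of the two.
  span : (Fin n → Bool) → Fin n → Fin n → ℕ
  span P u v = 2 * U u v ∸ (rad u + rad v) + 2 * detour P u v

  -- The diagonal is treated apart because `span` would send an unplanted point down to a terminal
  -- and back to itself.
  dist : (Fin n → Bool) → Fin n → Fin n → ℕ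
  dist P u v with u Fin.≟ v
  ... | yes _ = 0
  ... | no  _ = span P u v

  dist-refl : ∀ P u → dist P u u ≡ 0
  dist-refl P u with u Fin.≟ u
  ... | yes _ = refl
  ... | no ne = ⊥-elim (ne refl)

  dist-≢ : ∀ P {u v} → u ≢ v → dist P u v ≡ span P u v
  dist-≢ P {u} {v} ne with u Fin.≟ v
  ... | yes e = ⊥-elim (ne e)
  ... | no  _ = refl

  rads≤2U : ∀ u v → rad u + rad v ≤ 2 * U u v
  rads≤2U u v = subst (rad u + rad v ≤_) (cong (λ z → U u v + z) (sym (+-identityʳ (U u v))))
    (+-mono-≤ (rad≤Uˡ u v) (rad≤Uʳ u v))

  span-+ : ∀ P u v → span P u v + (rad u + rad v) ≡ 2 * (U u v + detour P u v)
  span-+ P u v = begin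
    a ∸ r + 2 * e + r   ≡⟨ +-assoc (a ∸ r) (2 * e) r ⟩
    a ∸ r + (2 * e + r) ≡⟨ cong (λ z → a ∸ r + z) (+-comm (2 * e) r) ⟩
    a ∸ r + (r + 2 * e) ≡⟨ sym (+-assoc (a ∸ r) r (2 * e)) ⟩
    a ∸ r + r + 2 * e   ≡⟨ cong (_+ 2 * e) (m∸n+n≡m (rads≤2U u v)) ⟩
    a + 2 * e           ≡⟨ sym (*-distribˡ-+ 2 (U u v) e) ⟩
    2 * (U u v + e)     ∎
    where
    open ≡-Reasoning
    a = 2 * U u v
    r = rad u + rad v
    e = detour P u v

  detour-sym : ∀ P u v → detour P u v ≡ detour P v u
  detour-sym P u v = cong₂ (λ b r → if b then 0 else r) (∧-comm (P u) (P v)) (⊓-comm (rad u) (rad v))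

  span-sym : ∀ P u v → span P u v ≡ span P v u
  span-sym P u v = cong₂ (λ a b → a + 2 * b)
    (cong₂ (λ a b → 2 * a ∸ b) (U-sym u v) (+-comm (rad u) (rad v))) (detour-sym P u v)

  dist-sym : ∀ P u v → dist P u v ≡ dist P v u
  dist-sym P u v with u Fin.≟ v | v Fin.≟ u
  ... | yes _ | yes _ = refl
  ... | yes e | no ne = ⊥-elim (ne (sym e))
  ... | no ne | yes e = ⊥-elim (ne (sym e))
  ... | no _  | no _  = span-sym P u v

  -- One of `b` and `c` is above `a`, and the other is still above `r`.
  ultra-+ : ∀ {a b c r} → a ≤ b ⊔ c → r ≤ b → r ≤ c → a + r ≤ b + c
  ultra-+ {a} {b} {c} {r} p q s with ≤-total b c
  ... | inj₁ b≤c = ≤-trans (+-mono-≤ (subst (a ≤_) (m≤n⇒m⊔n≡n b≤c) p) q) (≤-reflexive (+-comm c b))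
  ... | inj₂ c≤b = +-mono-≤ (subst (a ≤_) (m≥n⇒m⊔n≡m c≤b) p) s

  private
    -- As `u` is unplanted, its detour towards `v` equals the smaller of the two radii. If that is
    -- `rad u`, it covers the detour between `u` and `x`. If it is `rad v`, it covers the term
    -- `rad v`, and the detour between `u` and `x`, being below both values of `U` on the right, is
    -- absorbed by the ultrametric inequality.
    unplanted-triangle : ∀ P u v x → P u ≡ false →
      U u x + rad v + detour P u x ≤ U u v + U v x + detour P u v
    unplanted-triangle P u v x pu with ≤-total (rad u) (rad v)
    ... | inj₁ u≤v = +-mono-≤ (ultra-+ (U-ultra u v x) (rad≤Uʳ u v) (rad≤Uˡ v x)) (begin
        detour P u x  ≤⟨ detour≤ P u x ⟩
        rad u ⊓ rad x ≤⟨ m⊓n≤m (rad u) (rad x) ⟩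
        rad u         ≡⟨ sym (m≤n⇒m⊓n≡m u≤v) ⟩
        rad u ⊓ rad v ≡⟨ cong (λ b → if b ∧ P v then 0 else rad u ⊓ rad v) (sym pu) ⟩
        detour P u v  ∎)
      where open ≤-Reasoning
    ... | inj₂ v≤u = begin
        U u x + rad v + detour P u x           ≡⟨ e (U u x) (rad v) (detour P u x) ⟩
        U u x + detour P u x + rad v           ≤⟨ +-mono-≤ (ultra-+ (U-ultra u v x)
           (≤-trans (detour≤ P u x) (≤-trans (m⊓n≤m (rad u) (rad x)) (rad≤Uˡ u v)))
           (≤-trans (detour≤ P u x) (≤-trans (m⊓n≤n (rad u) (rad x)) (rad≤Uʳ v x))))
           (≤-reflexive (trans (sym (m≥n⇒m⊓n≡n v≤u)) (cong (λ b → if b ∧ P v then 0 else rad u ⊓ rad v) (sym pu)))) ⟩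
        U u v + U v x + detour P u v           ∎
      where
      open ≤-Reasoning
      e : ∀ a b c → a + b + c ≡ a + c + b
      e = solve-∀

  -- Half of the triangle inequality for `span`, with the radii moved across to avoid subtraction.
  -- Between planted ends there is no detour and `U-ultra` suffices; otherwise one end is unplanted
  -- and, up to reversing the path, its own detour towards `v` is enough.
  half-triangle : ∀ P u v x →
    U u x + rad v + detour P u x ≤ U u v + U v x + (detour P u v + detour P v x)
  half-triangle P u v x with dichotomy (P u) | dichotomy (P x)
  ... | inj₁ pu | inj₁ px = +-mono-≤ (ultra-+ (U-ultra u v x) (rad≤Uʳ u v) (rad≤Uˡ v x))
    (subst (_≤ detour P u v + detour P v x)
           (cong₂ (λ a b → if a ∧ b then 0 else rad u ⊓ rad x) (sym pu) (sym px)) z≤n)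
  ... | inj₂ pu | _       = ≤-trans (unplanted-triangle P u v x pu) (+-monoʳ-≤ (U u v + U v x) (m≤m+n _ _))
  ... | inj₁ _  | inj₂ px = begin
    U u x + rad v + detour P u x                    ≡⟨ cong₂ (λ a b → a + rad v + b) (U-sym u x) (detour-sym P u x) ⟩
    U x u + rad v + detour P x u                    ≤⟨ unplanted-triangle P x v u px ⟩
    U x v + U v u + detour P x v                    ≡⟨ cong₂ _+_ (cong₂ _+_ (U-sym x v) (U-sym v u)) (detour-sym P x v) ⟩
    U v x + U u v + detour P v x                    ≡⟨ cong (λ z → z + detour P v x) (+-comm (U v x) (U u v)) ⟩
    U u v + U v x + detour P v x                    ≤⟨ +-monoʳ-≤ (U u v + U v x) (m≤n+m _ _) ⟩
    U u v + U v x + (detour P u v + detour P v x)   ∎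
    where open ≤-Reasoning

  span-triangle : ∀ P u v x → span P u x ≤ span P u v + span P v x
  span-triangle P u v x = +-cancelʳ-≤ (rad u + rad v + (rad v + rad x)) _ _ (begin
    span P u x + (ru + rv + (rv + rx))                ≡⟨ e₁ (span P u x) ru rv rx ⟩
    span P u x + (ru + rx) + 2 * rv                   ≡⟨ cong (_+ 2 * rv) (span-+ P u x) ⟩
    2 * (U u x + detour P u x) + 2 * rv               ≡⟨ e₂ (U u x) (detour P u x) rv ⟩
    2 * (U u x + rv + detour P u x)                   ≤⟨ *-monoʳ-≤ 2 (half-triangle P u v x) ⟩
    2 * (U u v + U v x + (detour P u v + detour P v x)) ≡⟨ e₃ (U u v) (U v x) (detour P u v) (detour P v x) ⟩
    2 * (U u v + detour P u v) + 2 * (U v x + detour P v x) ≡⟨ cong₂ _+_ (sym (span-+ P u v)) (sym (span-+ P v x)) ⟩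
    span P u v + (ru + rv) + (span P v x + (rv + rx)) ≡⟨ e₄ (span P u v) (span P v x) (ru + rv) (rv + rx) ⟩
    span P u v + span P v x + (ru + rv + (rv + rx))   ∎)
    where
    open ≤-Reasoning
    ru = rad u
    rv = rad v
    rx = rad x
    e₁ : ∀ s a b c → s + (a + b + (b + c)) ≡ s + (a + c) + 2 * b
    e₁ = solve-∀
    e₂ : ∀ a b c → 2 * (a + b) + 2 * c ≡ 2 * (a + c + b)
    e₂ = solve-∀
    e₃ : ∀ a b c d → 2 * (a + b + (c + d)) ≡ 2 * (a + c) + 2 * (b + d)
    e₃ = solve-∀
    e₄ : ∀ a b c d → a + c + (b + d) ≡ a + b + (c + d)
    e₄ = solve-∀

  dist-triangle : ∀ P u v x → dist P u x ≤ dist P u v + dist P v x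
  dist-triangle P u v x with u Fin.≟ x | u Fin.≟ v | v Fin.≟ x
  ... | yes _ | _        | _        = z≤n
  ... | no ne | yes refl | yes refl = ⊥-elim (ne refl)
  ... | no _  | yes refl | no _     = ≤-refl
  ... | no _  | no _     | yes refl = m≤m+n _ _
  ... | no _  | no _     | no _     = span-triangle P u v x

  Separated : (Fin n → Bool) → Set
  Separated P = ∀ u v → u ≢ v → rad u + rad v < 2 * U u v ⊎ 0 < detour P u v

  metric : (P : Fin n → Bool) → Separated P → Metric n
  metric P sep = natMetric (dist P) eq (dist-refl P) (dist-sym P) (dist-triangle P)
    where
    eq : ∀ u v → dist P u v ≡ 0 → u ≡ v
    eq u v e with u Fin.≟ v
    ... | yes p = p
    ... | no ne with sep u v ne
    ...   | inj₁ lt = ⊥-elim (<⇒≱ lt (m∸n≡0⇒m≤n (m+n≡0⇒m≡0 (2 * U u v ∸ (rad u + rad v)) e)))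
    ...   | inj₂ lt = ⊥-elim (<⇒≢ lt (sym (m+n≡0⇒m≡0 (detour P u v) (m+n≡0⇒n≡0 (2 * U u v ∸ (rad u + rad v)) e))))

-- Cuts, and the price of spanning trees on the leaves

Constant : (ℕ → ℕ) → List (ℕ × ℕ) → Set
Constant g = All (λ e → g (proj₁ e) ≡ g (proj₂ e))

cut₁ : (ℕ → ℕ) → ℕ × ℕ → ℕ
cut₁ g (a , b) with g a ≟ g b
... | yes _ = 0
... | no  _ = 1

cut : (ℕ → ℕ) → List (ℕ × ℕ) → ℕ
cut g F = sum (map (cut₁ g) F)

merge : ℕ → ℕ → ℕ → ℕ
merge c d x with x ≟ c
... | yes _ = d
... | no  _ = x

merge-≢ : ∀ {c d x} → x ≢ c → merge c d x ≡ x
merge-≢ {c} {d} {x} ne with x ≟ c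
... | yes e = ⊥-elim (ne e)
... | no  _ = refl

merge-≡ : ∀ c d → merge c d c ≡ d
merge-≡ c d with c ≟ c
... | yes _ = refl
... | no ne = ⊥-elim (ne refl)

cut₁-merge : ∀ g c d e → cut₁ (λ x → merge c d (g x)) e ≤ cut₁ g e
cut₁-merge g c d (a , b) with merge c d (g a) ≟ merge c d (g b) | g a ≟ g b
... | yes _ | _     = z≤n
... | no ne | yes e = ⊥-elim (ne (cong (merge c d) e))
... | no _  | no _  = ≤-refl

cut-merge : ∀ g c d F → cut (λ x → merge c d (g x)) F ≤ cut g F
cut-merge g c d []      = z≤n
cut-merge g c d (e ∷ F) = +-mono-≤ (cut₁-merge g c d e) (cut-merge g c d F)

length≤1+filter-≢ : ∀ (g : ℕ → ℕ) c P → AllPairs (λ p q → g p ≢ g q) P →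
  length P ≤ suc (length (filter (λ p → ¬? (g p ≟ c)) P))
length≤1+filter-≢ g c []      _         = z≤n
length≤1+filter-≢ g c (p ∷ P) (px ∷ ps) with g p ≟ c
... | no ne = subst (λ Q → suc (length P) ≤ suc (length Q)) (sym (filter-accept keep ne)) (s≤s (length≤1+filter-≢ g c P ps))
  where
  keep : ∀ q → Dec (g q ≢ c)
  keep q = ¬? (g q ≟ c)
... | yes e = s≤s (≤-reflexive (cong length (sym (trans (filter-reject keep (λ ne → ne e))
      (filter-all keep (All.map (λ {q} ne gq → ne (trans e (sym gq))) px))))))
  where
  keep : ∀ q → Dec (g q ≢ c)
  keep q = ¬? (g q ≟ c)

AllPairs-map-All : ∀ {Q : ℕ → Set} {R S : ℕ → ℕ → Set} → (∀ {p q} → Q p → Q q → R p q → S p q) →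
  ∀ {P} → All Q P → AllPairs R P → AllPairs S P
AllPairs-map-All f []       []       = []
AllPairs-map-All f (q ∷ qs) (r ∷ rs) = All.zipWith (λ (a , b) → f q a b) (qs , r) ∷ AllPairs-map-All f qs rs

-- Connectivity of F modulo the labelling g is expressed through labellings: whatever is coarser
-- than g and constant along F identifies all of P.
length≤1+cut : ∀ F g P → AllPairs (λ p q → g p ≢ g q) P →
  (∀ (g′ : ℕ → ℕ) → (∀ x y → g x ≡ g y → g′ x ≡ g′ y) → Constant g′ F → ∀ {p q} → p ∈ P → q ∈ P → g′ p ≡ g′ q) →
  length P ≤ suc (cut g F)
length≤1+cut [] g []          _         conn = z≤n
length≤1+cut [] g (p ∷ [])    _         conn = ≤-refl
length≤1+cut [] g (p ∷ q ∷ P) ((ne ∷ _) ∷ _) conn =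
  ⊥-elim (ne (conn g (λ _ _ e → e) [] (here refl) (there (here refl))))
length≤1+cut ((a , b) ∷ F) g P distinct conn with g a ≟ g b
... | yes e = length≤1+cut F g P distinct (λ g′ coarser const → conn g′ coarser (coarser a b e ∷ const))
-- Contract the edge: the class of `a` is absorbed by that of `b`, which costs at most one of the
-- distinct points, and the edge itself accounts for one unit of the cut.
... | no ne = ≤-trans (length≤1+filter-≢ g (g a) P distinct) (s≤s (≤-trans
    (length≤1+cut F m P′
      (AllPairs-map-All (λ p≢ q≢ ne′ e → ne′ (trans (sym (merge-≢ p≢)) (trans e (merge-≢ q≢))))
        (All.all-filter keep P) (AllPairs.filter⁺ keep distinct))
      (λ g′ coarser const p∈ q∈ → conn g′ (λ x y e → coarser x y (cong (merge (g a) (g b)) e))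
        (coarser a b (trans (merge-≡ (g a) (g b)) (sym (merge-≢ (λ e → ne (sym e))))) ∷ const)
        (proj₁ (∈-filter⁻ keep p∈)) (proj₁ (∈-filter⁻ keep q∈))))
    (s≤s (cut-merge g (g a) (g b) F))))
  where
  m : ℕ → ℕ
  m x = merge (g a) (g b) (g x)
  keep : ∀ p → Dec (g p ≢ g a)
  keep p = ¬? (g p ≟ g a)
  P′ : List ℕ
  P′ = filter keep P

∑< : ℕ → (ℕ → ℕ) → ℕ
∑< zero    f = 0
∑< (suc n) f = ∑< n f + f n

∑<-+ : ∀ n f g → ∑< n (λ i → f i + g i) ≡ ∑< n f + ∑< n g
∑<-+ zero    f g = refl
∑<-+ (suc n) f g = trans (cong (λ z → z + (f n + g n)) (∑<-+ n f g)) (e (∑< n f) (∑< n g) (f n) (g n))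
  where
  e : ∀ a b c d → a + b + (c + d) ≡ a + c + (b + d)
  e = solve-∀

∑<-mono : ∀ n f g → (∀ i → i < n → f i ≤ g i) → ∑< n f ≤ ∑< n g
∑<-mono zero    f g le = z≤n
∑<-mono (suc n) f g le = +-mono-≤ (∑<-mono n f g (λ i p → le i (m≤n⇒m≤1+n p))) (le n ≤-refl)

∑<-0 : ∀ n → ∑< n (λ _ → 0) ≡ 0
∑<-0 zero    = refl
∑<-0 (suc n) = trans (+-identityʳ (∑< n (λ _ → 0))) (∑<-0 n)

∑<-cong : ∀ n {f g} → (∀ i → f i ≡ g i) → ∑< n f ≡ ∑< n g
∑<-cong zero    eq = refl
∑<-cong (suc n) eq = cong₂ _+_ (∑<-cong n eq) (eq n)

module Spanning (h : ℕ) where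
  open Heights h

  price₁ : ℕ × ℕ → ℕ
  price₁ (a , b) = Dual (lev N a b)

  price : List (ℕ × ℕ) → ℕ
  price F = sum (map price₁ F)

  δ : ℕ → ℕ
  δ i = Dual (suc i) ∸ Dual i

  δ+Dual : ∀ i → δ i + Dual i ≡ Dual (suc i)
  δ+Dual i = m∸n+n≡m (Dual-mono (n≤1+n i))

  -- A layer-cake sum: `Dual` at the meeting height is the sum of its increments over the heights at
  -- which `a` and `b` are still apart. Truncation at `M` is for the induction.
  price₁-levels : ∀ M → M ≤ N → ∀ a b → ∑< M (λ i → δ i * cut₁ (halve i) (a , b)) ≤ Dual (M ⊓ lev N a b)
  price₁-levels zero    p a b = z≤n
  price₁-levels (suc M) p a b with halve M a ≟ halve M b
  ... | yes _ = begin
      ∑< M c + δ M * 0           ≡⟨ cong (λ z → ∑< M c + z) (*-zeroʳ (δ M)) ⟩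
      ∑< M c + 0                 ≡⟨ +-identityʳ _ ⟩
      ∑< M c                     ≤⟨ price₁-levels M (<⇒≤ p) a b ⟩
      Dual (M ⊓ lev N a b)       ≤⟨ Dual-mono (⊓-monoˡ-≤ (lev N a b) (n≤1+n M)) ⟩
      Dual (suc M ⊓ lev N a b)   ∎
    where
    open ≤-Reasoning
    c : ℕ → ℕ
    c i = δ i * cut₁ (halve i) (a , b)
  ... | no ne = begin
      ∑< M c + δ M * 1           ≡⟨ cong (λ z → ∑< M c + z) (*-identityʳ (δ M)) ⟩
      ∑< M c + δ M               ≤⟨ +-monoˡ-≤ (δ M) (≤-trans (price₁-levels M (<⇒≤ p) a b) (Dual-mono (m⊓n≤m M _))) ⟩
      Dual M + δ M               ≡⟨ trans (+-comm (Dual M) (δ M)) (δ+Dual M) ⟩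
      Dual (suc M)               ≡⟨ cong Dual (sym (m≤n⇒m⊓n≡m (≰⇒> (λ le → ne (lev-sound< N a b M p le))))) ⟩
      Dual (suc M ⊓ lev N a b)   ∎
    where
    open ≤-Reasoning
    c : ℕ → ℕ
    c i = δ i * cut₁ (halve i) (a , b)

  price-levels : ∀ F → ∑< N (λ i → δ i * cut (halve i) F) ≤ price F
  price-levels [] = ≤-reflexive (trans (∑<-cong N (λ i → *-zeroʳ (δ i))) (∑<-0 N))
  price-levels ((a , b) ∷ F) = begin
    ∑< N (λ i → δ i * (cut₁ (halve i) (a , b) + cut (halve i) F))
      ≡⟨ ∑<-cong N (λ i → *-distribˡ-+ (δ i) (cut₁ (halve i) (a , b)) (cut (halve i) F)) ⟩
    ∑< N (λ i → δ i * cut₁ (halve i) (a , b) + δ i * cut (halve i) F)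
      ≡⟨ ∑<-+ N (λ i → δ i * cut₁ (halve i) (a , b)) (λ i → δ i * cut (halve i) F) ⟩
    ∑< N (λ i → δ i * cut₁ (halve i) (a , b)) + ∑< N (λ i → δ i * cut (halve i) F)
      ≤⟨ +-mono-≤ (≤-trans (price₁-levels N ≤-refl a b) (Dual-mono (m⊓n≤n N _))) (price-levels F) ⟩
    Dual (lev N a b) + price F ∎
    where open ≤-Reasoning

  Leaf : ℕ → Set
  Leaf p = 2 ^ N ≤ p × p < 2 * 2 ^ N

  -- Connectivity of the leaves, stated by labellings instead of paths because the links will come
  -- from separately built stars, and a labelling carries over from one to the next without any path
  -- being constructed.
  Spans : List (ℕ × ℕ) → Set
  Spans F = ∀ g → Constant g F → ∀ {p q} → Leaf p → Leaf q → g p ≡ g q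

  -- The leftmost leaves of the 2^(N-i) subtrees of height `i` have distinct ancestors at that
  -- height, so joining them all takes at least one cut edge less than their number.
  cut-bound : ∀ F → Spans F → ∀ i → i ≤ N → 2 ^ (N ∸ i) ≤ suc (cut (halve i) F)
  cut-bound F spans i i≤N = subst (_≤ suc (cut (halve i) F)) (length-applyUpTo point b)
    (length≤1+cut F (halve i) P
      (AllPairs.applyUpTo⁺₁ point b (λ {x} {y} x<y _ e → <⇒≢ x<y (+-cancelˡ-≡ b x y
        (trans (sym (halve-*2^ i (b + x))) (trans e (halve-*2^ i (b + y)))))))
      (λ g′ _ const p∈ q∈ → spans g′ const (leaf p∈) (leaf q∈)))
    where
    b = 2 ^ (N ∸ i)
    point : ℕ → ℕ
    point x = (b + x) * 2 ^ i
    P : List ℕ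
    P = applyUpTo point b
    b*2^i : b * 2 ^ i ≡ 2 ^ N
    b*2^i = trans (sym (^-distribˡ-+-* 2 (N ∸ i) i)) (cong (2 ^_) (m∸n+n≡m i≤N))
    leaf : ∀ {p} → p ∈ P → Leaf p
    leaf p∈ with ∈-applyUpTo⁻ point p∈
    ... | x , x<b , refl =
      subst (_≤ point x) b*2^i (*-monoˡ-≤ (2 ^ i) (m≤m+n b x)) ,
      subst (point x <_) (trans (*-assoc 2 b (2 ^ i)) (cong (2 *_) b*2^i))
        (*-monoˡ-< (2 ^ i) {{m^n≢0 2 i}} (subst (λ z → b + x < b + z) (sym (+-identityʳ b)) (+-monoʳ-< b x<b)))

  private
    -- The subtracted ones, weighted by the increments, telescope to `Dual M`.
    weights : ∀ M → M ≤ N → ∑< M (λ i → δ i * (2 ^ (N ∸ i) ∸ 1)) + Dual M ≡ ∑< M (λ i → δ i * 2 ^ (N ∸ i))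
    weights zero    _ = Dual-low z≤n
    weights (suc M) p = begin
      ∑< M c + δ M * (2 ^ (N ∸ M) ∸ 1) + Dual (suc M)      ≡⟨ cong (λ z → ∑< M c + δ M * (2 ^ (N ∸ M) ∸ 1) + z) (sym (δ+Dual M)) ⟩
      ∑< M c + δ M * (2 ^ (N ∸ M) ∸ 1) + (δ M + Dual M)    ≡⟨ e (∑< M c) (δ M) (2 ^ (N ∸ M) ∸ 1) (Dual M) ⟩
      ∑< M c + Dual M + δ M * (2 ^ (N ∸ M) ∸ 1 + 1)        ≡⟨ cong₂ (λ y z → y + δ M * z) (weights M (<⇒≤ p)) (m∸n+n≡m (m^n>0 2 (N ∸ M))) ⟩
      ∑< M d + δ M * 2 ^ (N ∸ M)                           ∎
      where
      open ≡-Reasoning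
      c d : ℕ → ℕ
      c i = δ i * (2 ^ (N ∸ i) ∸ 1)
      d i = δ i * 2 ^ (N ∸ i)
      e : ∀ a b c d → a + b * c + (b + d) ≡ a + d + b * (c + 1)
      e = solve-∀

  spanning-bound : ∀ F → Spans F → ∑< N (λ i → δ i * 2 ^ (N ∸ i)) ≤ price F + Dual N
  spanning-bound F spans = begin
    ∑< N (λ i → δ i * 2 ^ (N ∸ i))                  ≡⟨ sym (weights N ≤-refl) ⟩
    ∑< N (λ i → δ i * (2 ^ (N ∸ i) ∸ 1)) + Dual N   ≤⟨ +-monoˡ-≤ (Dual N) (∑<-mono N _ _ (λ i i<N →
        *-monoʳ-≤ (δ i) (∸-monoˡ-≤ 1 (cut-bound F spans i (<⇒≤ i<N))))) ⟩
    ∑< N (λ i → δ i * cut (halve i) F) + Dual N     ≤⟨ +-monoˡ-≤ (Dual N) (price-levels F) ⟩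
    price F + Dual N                                ∎
    where open ≤-Reasoning

module SpanningValue where
  open Heights
  open Spanning

  private
    low : ∀ h i → suc i ≤ H h → δ h i ≡ dual (suc i) ∸ dual i
    low h i p = cong₂ _∸_ (Dual-low h p) (Dual-low h (<⇒≤ p))

    -- The increment doubles as the number of subtrees halves, so all middle levels contribute
    -- equally.
    term : ∀ h j → suc (suc (suc j)) ≤ H h → δ h (suc (suc j)) * 2 ^ (N h ∸ suc (suc j)) ≡ 5 * 2 ^ H h
    term h j p = begin
      δ h (suc (suc j)) * 2 ^ d         ≡⟨ cong (λ z → z * 2 ^ d) (trans (low h (suc (suc j)) p) δ-dual) ⟩
      10 * 2 ^ j * 2 ^ d                ≡⟨ e (2 ^ j) (2 ^ d) ⟩
      5 * (2 ^ suc j * 2 ^ d)           ≡⟨ cong (5 *_) (sym (^-distribˡ-+-* 2 (suc j) d)) ⟩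
      5 * 2 ^ (suc j + d)               ≡⟨ cong (λ z → 5 * 2 ^ z) (m+[n∸m]≡n (≤-trans (n≤1+n (suc j)) (<⇒≤ p))) ⟩
      5 * 2 ^ H h                       ∎
      where
      open ≡-Reasoning
      d = H h ∸ suc j
      e : ∀ a b → 10 * a * b ≡ 5 * (2 * a * b)
      e = solve-∀
      e′ : ∀ a → 10 * (2 * a) ≡ 10 * a + 10 * a
      e′ = solve-∀
      δ-dual : 10 * (2 * 2 ^ j) ∸ 10 * 2 ^ j ≡ 10 * 2 ^ j
      δ-dual = trans (cong (λ z → z ∸ 10 * 2 ^ j) (e′ (2 ^ j))) (m+n∸n≡m (10 * 2 ^ j) (10 * 2 ^ j))

    level-sum : ℕ → ℕ → ℕ
    level-sum h M = ∑< M (λ i → δ h i * 2 ^ (N h ∸ i))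

    prefix-value : ∀ h j → suc (suc j) ≤ H h → level-sum h (suc (suc j)) ≡ (5 * (2 + j) + 4) * 2 ^ H h
    prefix-value (suc h) zero    p = trans (cong₂ (λ a b → a * 2 ^ N (suc h) + b * 2 ^ H (suc h))
      (low (suc h) 0 (s≤s z≤n)) (low (suc h) 1 (s≤s (s≤s z≤n)))) (e (2 ^ H (suc h)))
      where
      e : ∀ p → 4 * (2 * p) + 6 * p ≡ 14 * p
      e = solve-∀
    prefix-value zero (suc j) (s≤s ())
    prefix-value (suc h) (suc j) p = trans (cong₂ _+_ (prefix-value (suc h) j (<⇒≤ p)) (term (suc h) j p)) (e j (2 ^ H (suc h)))
      where
      e : ∀ j p → (5 * (2 + j) + 4) * p + 5 * p ≡ (5 * (3 + j) + 4) * p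
      e = solve-∀

  -- In units of 2^H and for H ≥ 2: levels 0 and 1 give 8 and 6, levels 2 to H - 1 give 5 each, and
  -- level H, cut short by the override at the top, gives 1.
  level-sum-value : ∀ h → ∑< (N h) (λ i → δ h i * 2 ^ (N h ∸ i)) ≡ (5 * H h + 5) * 2 ^ H h
  level-sum-value zero rewrite Dual-low 0 {0} z≤n | Dual-low 0 {1} ≤-refl | Dual-top 0 {2} ≤-refl = refl
  level-sum-value (suc h) = begin
    level-sum (suc h) (2 + h) + δ (suc h) (2 + h) * 2 ^ (N (suc h) ∸ (2 + h))
      ≡⟨ cong₂ (λ a b → a + b * 2 ^ (N (suc h) ∸ (2 + h))) (prefix-value (suc h) h ≤-refl) δ-top ⟩
    (5 * (2 + h) + 4) * 2 ^ H (suc h) + 2 * 2 ^ h * 2 ^ (N (suc h) ∸ (2 + h))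
      ≡⟨ cong (λ z → (5 * (2 + h) + 4) * 2 ^ H (suc h) + 2 * 2 ^ h * 2 ^ z) (m+n∸n≡m 1 (2 + h)) ⟩
    (5 * (2 + h) + 4) * 2 ^ H (suc h) + 2 * 2 ^ h * 2
      ≡⟨ e h (2 ^ h) ⟩
    (5 * H (suc h) + 5) * 2 ^ H (suc h) ∎
    where
    open ≡-Reasoning
    e : ∀ h p → (5 * (2 + h) + 4) * (2 * (2 * p)) + 2 * p * 2 ≡ (5 * (2 + h) + 5) * (2 * (2 * p))
    e = solve-∀
    e′ : ∀ p → 3 * (2 * (2 * p)) ≡ 2 * p + 10 * p
    e′ = solve-∀
    δ-top : δ (suc h) (2 + h) ≡ 2 * 2 ^ h
    δ-top = trans (cong₂ _∸_ (trans (Dual-top (suc h) ≤-refl) (e′ (2 ^ h))) (Dual-low (suc h) ≤-refl))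
                  (m+n∸n≡m (2 * 2 ^ h) (10 * 2 ^ h))

  spans⇒price : ∀ h F → Spans h F → (5 * H h + 2) * 2 ^ H h ≤ price h F
  spans⇒price h F spans = +-cancelʳ-≤ (3 * 2 ^ H h) _ _ (begin
    (5 * H h + 2) * 2 ^ H h + 3 * 2 ^ H h           ≡⟨ e (H h) (2 ^ H h) ⟩
    (5 * H h + 5) * 2 ^ H h                         ≡⟨ sym (level-sum-value h) ⟩
    ∑< (N h) (λ i → δ h i * 2 ^ (N h ∸ i))          ≤⟨ spanning-bound h F spans ⟩
    price h F + Dual h (N h)                        ≡⟨ cong (λ z → price h F + z) (Dual-top h ≤-refl) ⟩
    price h F + 3 * 2 ^ H h                         ∎)
    where
    open ≤-Reasoning
    e : ∀ a p → (5 * a + 2) * p + 3 * p ≡ (5 * a + 5) * p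
    e = solve-∀

-- Replacing a star by links among its terminals

module Stars (h : ℕ) where
  open Heights h
  open Spanning h

  -- Distance in the hidden tree from the node of height `j` above leaf `x` to the leaf `t`.
  hop : ℕ → ℕ → ℕ → ℕ
  hop x j t = 2 * Radius (j ⊔ lev N x t) ∸ Radius j

  hops : ℕ → ℕ → List ℕ → ℕ
  hops x j ts = sum (map (hop x j) ts)

  fan : ℕ → List ℕ → List (ℕ × ℕ)
  fan a = map (a ,_)

  Attached : List (ℕ × ℕ) → ℕ → List ℕ → Set
  Attached F a ts = ∀ g → Constant g F → All (λ t → g t ≡ g a) ts

  fan-attached : ∀ a ts → Attached (fan a ts) a ts
  fan-attached a []       g []      = []
  fan-attached a (t ∷ ts) g (e ∷ c) = sym e ∷ fan-attached a ts g c

  price-++ : ∀ F G → price (F ++ G) ≡ price F + price G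
  price-++ F G = trans (cong sum (map-++ price₁ F G)) (sum-++ (map price₁ F) (map price₁ G))

  fan-price : ∀ x j a ts → All (λ t → Dual (lev N a t) ≤ hop x j t) ts → price (fan a ts) ≤ hops x j ts
  fan-price x j a []       []       = z≤n
  fan-price x j a (t ∷ ts) (p ∷ ps) = +-mono-≤ p (fan-price x j a ts ps)

  record Split (P Q : ℕ → Set) (ts : List ℕ) : Set where
    constructor split
    field
      ins outs : List ℕ
      ins-P    : All P ins
      outs-Q   : All Q outs
      perm     : ins ++ outs ↭ ts

  splitBy : ∀ {P Q : ℕ → Set} {ts} → All (λ t → P t ⊎ Q t) ts → Split P Q ts
  splitBy [] = split [] [] [] [] ↭-refl
  splitBy {ts = t ∷ ts} (inj₁ p ∷ as) with splitBy as
  ... | split is os ps qs eq = split (t ∷ is) os (p ∷ ps) qs (prep t eq)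
  splitBy {ts = t ∷ ts} (inj₂ q ∷ as) with splitBy as
  ... | split is os ps qs eq = split is (t ∷ os) ps (q ∷ qs) (↭-trans (shift t is os) (prep t eq))

  -- A partial result that can be extended: `hub-near` keeps the hub so close to `x` that a further
  -- group of terminals can be linked to it at the price of its distance from `x`.
  record Cluster (x m budget : ℕ) (ts : List ℕ) : Set where
    constructor cluster
    field
      hub      : ℕ
      links    : List (ℕ × ℕ)
      hub-near : lev N x hub ≤ m
      afford   : price links ≤ budget
      attached : Attached links hub ts

  private
    near-pair : ∀ x m a t → lev N x a ≤ m → lev N x t ≤ m → lev N a t ≤ m
    near-pair x m a t p q = ≤-trans (lev-ultra N a x t) (⊔-lub (subst (_≤ m) (lev-sym N x a) p) q)

    hop-level : ∀ x j t {i} → j ⊔ lev N x t ≡ i → hop x j t ≡ 2 * Radius i ∸ Radius j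
    hop-level x j t refl = refl

    hop-inside : ∀ x j t → lev N x t ≤ j → hop x j t ≡ Radius j
    hop-inside x j t p = trans (hop-level x j t (m≥n⇒m⊔n≡m p))
      (trans (cong (λ z → Radius j + z ∸ Radius j) (+-identityʳ (Radius j))) (m+n∸m≡n (Radius j) (Radius j)))

    hop-outside : ∀ x j t {i} → lev N x t ≡ i → j ≤ i → hop x j t ≡ 2 * Radius i ∸ Radius j
    hop-outside x j t refl p = hop-level x j t (m≤n⇒m⊔n≡n p)

    to-hop : ∀ {a b c} → a + b ≤ c → a ≤ c ∸ b
    to-hop {a} {b} {c} p = subst (_≤ c ∸ b) (m+n∸n≡m a b) (∸-monoˡ-≤ b p)

  module Centre (x j′ : ℕ) (j≤H : suc j′ ≤ H) where
    j : ℕ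
    j = suc j′

    Top : ℕ → Set
    Top t = halve N x ≡ halve N t

    -- Where a terminal lies relative to the centre: under the child that contains `x`, under the
    -- other child, under the sibling of the centre, or beyond the grandparent's other branch and
    -- above.
    Left Right Sibling Far : ℕ → Set
    Left t    = lev N x t ≤ j′
    Right t   = lev N x t ≡ j
    Sibling t = lev N x t ≡ suc j
    Far t     = suc (suc j) ≤ lev N x t

    inside-fan : ∀ a ts → All (λ t → lev N a t ≤ j′) ts → All (λ t → lev N x t ≤ j) ts → price (fan a ts) ≤ hops x j ts
    inside-fan a ts ps qs = fan-price x j a ts (All.zipWith (λ {t} (p , q) →
      subst (Dual (lev N a t) ≤_) (sym (hop-inside x j t q)) (≤-trans (Dual-mono p) (Dual≤Radius-suc j≤H))) (ps , qs))

    left-fan : ∀ a ts → Left a → All Left ts → price (fan a ts) ≤ hops x j ts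
    left-fan a ts p ps = inside-fan a ts (All.map (λ {t} q → near-pair x j′ a t p q) ps) (All.map m≤n⇒m≤1+n ps)

    right-fan : ∀ a ts → Top a → All Top ts → Right a → All Right ts → price (fan a ts) ≤ hops x j ts
    right-fan a ts top tops p ps = inside-fan a ts
      (All.zipWith (λ {t} (q , r) → lev-binary N x a t j′ top r p q) (ps , tops)) (All.map ≤-reflexive ps)

    sibling-fan : ∀ a ts → Top a → All Top ts → Sibling a → All Sibling ts → price (fan a ts) ≤ hops x j ts
    sibling-fan a ts top tops p ps = fan-price x j a ts (All.zipWith (λ {t} (q , r) →
      subst (Dual (lev N a t) ≤_) (sym (hop-outside x j t q (n≤1+n j)))
        (≤-trans (Dual-mono (lev-binary N x a t j top r p q)) (to-hop (Dual-next j≤H)))) (ps , tops))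

    far-fan : ∀ a ts → lev N x a ≤ suc j → All Far ts → price (fan a ts) ≤ hops x j ts
    far-fan a ts p ps = fan-price x j a ts (All.map (λ {t} q →
      subst (Dual (lev N a t) ≤_) (sym (hop-outside x j t refl (<⇒≤ (<⇒≤ q))))
        (≤-trans (Dual-mono (near-pair x (lev N x t) a t (≤-trans p (<⇒≤ q)) ≤-refl))
          (to-hop (Dual-far q (lev≤ N x t))))) ps)

    -- What an inside cluster must save in order to be joined to the sibling subtree.
    Slack : ℕ → Set
    Slack σ = Dual (suc j) + Radius j ≤ σ + 2 * Radius (suc j)

    -- Of the budget `B`, the part `σ` is left unspent; it comes from the hops of terminals that
    -- need no link of their own.
    Inside : ℕ → List ℕ → Set
    Inside B ts = ts ≡ [] ⊎ (∃[ σ ] ∃[ b ] (σ + b ≡ B × Slack σ × Cluster x j b ts))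

    -- With terminals under one child only, the hop of the hub is saved whole.
    one-slack : Slack (Radius j)
    one-slack = subst (Dual (suc j) + Radius j ≤_) (+-comm (2 * Radius (suc j)) (Radius j))
      (+-monoˡ-≤ (Radius j) (Dual≤2Radius (suc j)))

    -- With terminals under both children two hops are saved, but one link of price `Dual j` joins
    -- the two sides. This is the tight case of the accounts.
    two-slack : Slack (2 * Radius j ∸ Dual j)
    two-slack = +-cancelʳ-≤ (Dual j) _ _ (begin
      Dual (suc j) + r + Dual j                      ≡⟨ e (Dual (suc j)) r (Dual j) ⟩
      r + (Dual j + Dual (suc j))                    ≤⟨ +-monoʳ-≤ r (Dual-pair (s≤s z≤n) j≤H) ⟩
      r + (r + 2 * Radius (suc j))                   ≡⟨ e′ r (2 * Radius (suc j)) ⟩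
      2 * r + 2 * Radius (suc j)                     ≡⟨ cong (λ z → z + 2 * Radius (suc j)) (sym (m∸n+n≡m (Dual≤2Radius j))) ⟩
      2 * r ∸ Dual j + Dual j + 2 * Radius (suc j)   ≡⟨ e″ (2 * r ∸ Dual j) (Dual j) (2 * Radius (suc j)) ⟩
      2 * r ∸ Dual j + 2 * Radius (suc j) + Dual j   ∎)
      where
      open ≤-Reasoning
      r = Radius j
      e : ∀ a b c → a + b + c ≡ b + (c + a)
      e = solve-∀
      e′ : ∀ a b → a + (a + b) ≡ 2 * a + b
      e′ = solve-∀
      e″ : ∀ a b c → a + b + c ≡ a + c + b
      e″ = solve-∀

    fan-attached-hub : ∀ a ts → Attached (fan a ts) a (a ∷ ts)
    fan-attached-hub a ts g c = refl ∷ fan-attached a ts g c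

    inside : ∀ L R → All Left L → All Right R → All Top R → Inside (hops x j L + hops x j R) (L ++ R)
    inside [] [] _ _ _ = inj₁ refl
    inside (a ∷ L) [] (p ∷ ps) _ _ = inj₂ (Radius j , hops x j L ,
      trans (cong (λ z → z + hops x j L) (sym (hop-inside x j a (m≤n⇒m≤1+n p)))) (sym (+-identityʳ _)) , one-slack ,
      cluster a (fan a L) (m≤n⇒m≤1+n p) (left-fan a L p ps)
        (subst (λ ts → Attached (fan a L) a (a ∷ ts)) (sym (++-identityʳ L)) (fan-attached-hub a L)))
    inside [] (b ∷ R) _ (q ∷ qs) (t ∷ ts) = inj₂ (Radius j , hops x j R ,
      cong (λ z → z + hops x j R) (sym (hop-inside x j b (≤-reflexive q))) , one-slack ,
      cluster b (fan b R) (≤-reflexive q) (right-fan b R t ts q qs) (fan-attached-hub b R))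
    inside (a ∷ L) (b ∷ R) (p ∷ ps) (q ∷ qs) (t ∷ ts) =
      inj₂ (2 * Radius j ∸ Dual j , Dual j + (hops x j L + hops x j R) , budget , two-slack ,
        cluster a ((a , b) ∷ (fan a L ++ fan b R)) (m≤n⇒m≤1+n p) paid linked)
      where
      r = Radius j
      budget : 2 * r ∸ Dual j + (Dual j + (hops x j L + hops x j R)) ≡ hop x j a + hops x j L + (hop x j b + hops x j R)
      budget = begin
        2 * r ∸ Dual j + (Dual j + (hops x j L + hops x j R)) ≡⟨ sym (+-assoc (2 * r ∸ Dual j) (Dual j) _) ⟩
        2 * r ∸ Dual j + Dual j + (hops x j L + hops x j R)   ≡⟨ cong (λ z → z + (hops x j L + hops x j R)) (m∸n+n≡m (Dual≤2Radius j)) ⟩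
        2 * r + (hops x j L + hops x j R)                     ≡⟨ e r (hops x j L) (hops x j R) ⟩
        r + hops x j L + (r + hops x j R)                     ≡⟨ cong₂ (λ y z → y + hops x j L + (z + hops x j R))
                                                                   (sym (hop-inside x j a (m≤n⇒m≤1+n p))) (sym (hop-inside x j b (≤-reflexive q))) ⟩
        hop x j a + hops x j L + (hop x j b + hops x j R)     ∎
        where
        open ≡-Reasoning
        e : ∀ r a b → 2 * r + (a + b) ≡ r + a + (r + b)
        e = solve-∀
      paid : Dual (lev N a b) + price (fan a L ++ fan b R) ≤ Dual j + (hops x j L + hops x j R)
      paid = +-mono-≤ (Dual-mono (near-pair x j a b (m≤n⇒m≤1+n p) (≤-reflexive q)))
        (subst (_≤ hops x j L + hops x j R) (sym (price-++ (fan a L) (fan b R)))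
          (+-mono-≤ (left-fan a L p ps) (right-fan b R t ts q qs)))
      linked : Attached ((a , b) ∷ (fan a L ++ fan b R)) a (a ∷ (L ++ (b ∷ R)))
      linked g (e ∷ c) = refl ∷ All.++⁺ (fan-attached a L g (All.++⁻ˡ (fan a L) c))
        (sym e ∷ All.map (λ e′ → trans e′ (sym e)) (fan-attached b R g (All.++⁻ʳ (fan a L) c)))

    -- One bridge joins the inside cluster to the sibling subtree, paid by the slack together with
    -- the hop of one sibling terminal; the remaining siblings are linked to that one.
    near : ∀ {B} I O → Inside B I → All Sibling O → All Top O → (I ++ O ≡ []) ⊎ Cluster x (suc j) (B + hops x j O) (I ++ O)
    near I []       (inj₁ refl) _ _ = inj₁ refl
    near {B} I (b ∷ O) (inj₁ refl) (q ∷ qs) (t ∷ ts) = inj₂ (cluster b (fan b O) (≤-reflexive q)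
      (≤-trans (sibling-fan b O t ts q qs) (≤-trans (m≤n+m _ (hop x j b)) (m≤n+m _ B))) (fan-attached-hub b O))
    near I [] (inj₂ (σ , c , refl , _ , cluster a F n p att)) _ _ = inj₂ (cluster a F (m≤n⇒m≤1+n n)
      (≤-trans p (≤-trans (m≤n+m c σ) (m≤m+n (σ + c) 0))) (subst (Attached F a) (sym (++-identityʳ I)) att))
    near I (b ∷ O) (inj₂ (σ , c , refl , slack , cluster a F n p att)) (q ∷ qs) (t ∷ ts) =
      inj₂ (cluster a ((a , b) ∷ (F ++ fan b O)) (m≤n⇒m≤1+n n) paid linked)
      where
      bridge : Dual (lev N a b) ≤ σ + hop x j b
      bridge = begin
        Dual (lev N a b)                        ≤⟨ Dual-mono (near-pair x (suc j) a b (m≤n⇒m≤1+n n) (≤-reflexive q)) ⟩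
        Dual (suc j)                            ≤⟨ to-hop slack ⟩
        σ + 2 * Radius (suc j) ∸ Radius j       ≡⟨ +-∸-assoc σ (≤-trans (Radius-mono (n≤1+n j)) (m≤m+n _ _)) ⟩
        σ + (2 * Radius (suc j) ∸ Radius j)     ≡⟨ cong (λ z → σ + z) (sym (hop-outside x j b q (n≤1+n j))) ⟩
        σ + hop x j b                           ∎
        where open ≤-Reasoning
      paid : Dual (lev N a b) + price (F ++ fan b O) ≤ σ + c + (hop x j b + hops x j O)
      paid = begin
        Dual (lev N a b) + price (F ++ fan b O)        ≡⟨ cong (λ z → Dual (lev N a b) + z) (price-++ F (fan b O)) ⟩
        Dual (lev N a b) + (price F + price (fan b O)) ≤⟨ +-mono-≤ bridge (+-mono-≤ p (sibling-fan b O t ts q qs)) ⟩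
        σ + hop x j b + (c + hops x j O)               ≡⟨ e σ (hop x j b) c (hops x j O) ⟩
        σ + c + (hop x j b + hops x j O)               ∎
        where
        open ≤-Reasoning
        e : ∀ a b c d → a + b + (c + d) ≡ a + c + (b + d)
        e = solve-∀
      linked : Attached ((a , b) ∷ (F ++ fan b O)) a (I ++ (b ∷ O))
      linked g (e ∷ c) = All.++⁺ (att g (All.++⁻ˡ F c))
        (sym e ∷ All.map (λ e′ → trans e′ (sym e)) (fan-attached b O g (All.++⁻ʳ F c)))

    all : ∀ {B} I Z → (I ≡ []) ⊎ Cluster x (suc j) B I → All Far Z → Cluster x (suc j) (B + hops x j Z) (I ++ Z)
    -- With far terminals only, the leaf `x` serves as hub although it need not be a terminal of the
    -- star: a far hop is long enough to pay for a link all the way to `x`.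
    all {B} I Z (inj₁ refl) far = cluster x (fan x Z) (subst (_≤ suc j) (sym (lev-refl N x)) z≤n)
      (≤-trans (far-fan x Z (subst (_≤ suc j) (sym (lev-refl N x)) z≤n) far) (m≤n+m _ B)) (fan-attached x Z)
    all {B} I Z (inj₂ (cluster a F n p att)) far = cluster a (F ++ fan a Z) n
      (subst (_≤ B + hops x j Z) (sym (price-++ F (fan a Z))) (+-mono-≤ p (far-fan a Z n far)))
      (λ g c → All.++⁺ (att g (All.++⁻ˡ F c)) (fan-attached a Z g (All.++⁻ʳ F c)))

    classify : ∀ t → (Left t ⊎ Right t) ⊎ (Sibling t ⊎ Far t)
    classify t with lev N x t ≤? j′ | lev N x t ≟ j | lev N x t ≟ suc j
    ... | yes p | _     | _     = inj₁ (inj₁ p)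
    ... | no _  | yes p | _     = inj₁ (inj₂ p)
    ... | no _  | no _  | yes p = inj₂ (inj₁ p)
    ... | no a  | no b  | no c  = inj₂ (inj₂ (≤∧≢⇒< (≤∧≢⇒< (≰⇒> a) (λ e → b (sym e))) (λ e → c (sym e))))

  hops-++ : ∀ x j L R → hops x j (L ++ R) ≡ hops x j L + hops x j R
  hops-++ x j L R = trans (cong sum (map-++ (hop x j) L R)) (sum-++ (map (hop x j) L) (map (hop x j) R))

  -- At height 0 the centre is itself a leaf that has to be connected, so the hub must be that leaf.
  -- For a hidden centre any hub will do.
  star : ∀ x j ts → j ≤ H → All (λ t → halve N x ≡ halve N t) ts →
    ∃ λ F → price F ≤ hops x j ts × ∃ λ hub → (j ≡ 0 → hub ≡ x) × Attached F hub ts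
  star x zero ts _ _ = fan x ts ,
    fan-price x 0 x ts (All.universal (λ t → subst (λ z → Dual (lev N x t) ≤ 2 * Radius (lev N x t) ∸ z)
      (sym (Radius-low z≤n)) (Dual≤2Radius (lev N x t))) ts) ,
    x , (λ _ → refl) , fan-attached x ts
  star x (suc j′) ts j≤H tops = links , paid , hub , (λ ()) , λ g c → All-resp-↭ perm-ts (attached g c)
    where
    open Centre x j′ j≤H
    open Split (splitBy {λ t → (Left t ⊎ Right t) × Top t} {λ t → (Sibling t ⊎ Far t) × Top t}
      (All.map (λ {t} top → [ (λ p → inj₁ (p , top)) , (λ p → inj₂ (p , top)) ]′ (classify t)) tops))
      renaming (ins to LR; outs to OZ; ins-P to LR-P; outs-Q to OZ-Q; perm to perm₀)
    open Split (splitBy {Left} {λ t → Right t × Top t} (All.map (λ (p , top) → [ inj₁ , (λ q → inj₂ (q , top)) ]′ p) LR-P))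
      renaming (ins to L; outs to R; ins-P to L-P; outs-Q to R-P; perm to perm₁)
    open Split (splitBy {λ t → Sibling t × Top t} {Far} (All.map (λ (p , top) → [ (λ q → inj₁ (q , top)) , inj₂ ]′ p) OZ-Q))
      renaming (ins to O; outs to Z; ins-P to O-P; outs-Q to Z-P; perm to perm₂)
    perm-ts : ((L ++ R) ++ O) ++ Z ↭ ts
    perm-ts = subst (_↭ ts) (sym (++-assoc (L ++ R) O Z)) (↭-trans (++⁺ perm₁ perm₂) perm₀)
    open Cluster (all ((L ++ R) ++ O) Z
      (near (L ++ R) O (inside L R L-P (All.map proj₁ R-P) (All.map proj₂ R-P)) (All.map proj₁ O-P) (All.map proj₂ O-P)) Z-P)
    paid : price links ≤ hops x (suc j′) ts
    paid = ≤-trans afford (≤-reflexive (begin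
      hs L + hs R + hs O + hs Z       ≡⟨ cong (λ z → z + hs O + hs Z) (sym (hops-++ x (suc j′) L R)) ⟩
      hs (L ++ R) + hs O + hs Z       ≡⟨ cong (λ z → z + hs Z) (sym (hops-++ x (suc j′) (L ++ R) O)) ⟩
      hs ((L ++ R) ++ O) + hs Z       ≡⟨ sym (hops-++ x (suc j′) ((L ++ R) ++ O) Z) ⟩
      hs (((L ++ R) ++ O) ++ Z)       ≡⟨ sum-↭ (map⁺ (hop x (suc j′)) perm-ts) ⟩
      hs ts                           ∎))
      where
      open ≡-Reasoning
      hs = hops x (suc j′)

-- The lower bound for Steiner trees in the unplanted metric

sumℚ-⟦⟧ : ∀ {A : Set} (c : A → ℕ) xs → sumℚ (map (λ e → ⟦ c e ⟧) xs) ≡ ⟦ sum (map c xs) ⟧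
sumℚ-⟦⟧ c []       = sym ⟦0⟧≡0ℚ
sumℚ-⟦⟧ c (x ∷ xs) = trans (cong (λ z → ⟦ c x ⟧ ℚ.+ z) (sumℚ-⟦⟧ c xs)) (sym (⟦⟧-+ (c x) (sum (map c xs))))

module Unplanted (h : ℕ) {n : ℕ} (pos ht : Fin n → ℕ)
  (ht≤H : ∀ v → ht v ≤ suc h) (top : ∀ v → halve (suc (suc h)) (pos v) ≡ 1) where
  open Heights h
  open Spanning h
  open Stars h
  open Points h pos ht

  nowhere : Fin n → Bool
  nowhere _ = false

  HalfEdge : Set
  HalfEdge = Fin n × ℕ

  hop-at : HalfEdge → ℕ
  hop-at (v , t) = hop (pos v) (ht v) t

  private
    -- The detour passes through the leaf of the lower endpoint: `u` descends to it at cost `rad u`,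
    -- and the rest is the tree path from this leaf to `v`.
    split-span : ∀ u v → ht u ≤ ht v → hop-at (u , pos u) + hop-at (v , pos u) ≡ span nowhere u v
    split-span u v u≤v = begin
      hop-at (u , pos u) + hop-at (v , pos u)                ≡⟨ cong₂ _+_ own (cong (λ z → 2 * Radius z ∸ rad v) other) ⟩
      rad u + (2 * U u v ∸ rad v)                            ≡⟨ cong (λ z → rad u + (z ∸ rad v)) (sym (m∸n+n≡m (rads≤2U u v))) ⟩
      rad u + (X + (rad u + rad v) ∸ rad v)                  ≡⟨ cong (λ z → rad u + (z ∸ rad v)) (sym (+-assoc X (rad u) (rad v))) ⟩
      rad u + (X + rad u + rad v ∸ rad v)                    ≡⟨ cong (λ z → rad u + z) (m+n∸n≡m (X + rad u) (rad v)) ⟩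
      rad u + (X + rad u)                                    ≡⟨ e (rad u) X ⟩
      X + 2 * rad u                                          ≡⟨ cong (λ z → X + 2 * z) (sym (m≤n⇒m⊓n≡m (Radius-mono u≤v))) ⟩
      span nowhere u v                                       ∎
      where
      open ≡-Reasoning
      X = 2 * U u v ∸ (rad u + rad v)
      e : ∀ a b → a + (b + a) ≡ b + 2 * a
      e = solve-∀
      own : hop-at (u , pos u) ≡ rad u
      own = trans (cong (λ z → 2 * Radius (ht u ⊔ z) ∸ rad u) (lev-refl N (pos u)))
        (trans (cong (λ z → 2 * Radius z ∸ rad u) (⊔-identityʳ (ht u)))
          (trans (cong (λ z → rad u + z ∸ rad u) (+-identityʳ (rad u))) (m+n∸m≡n (rad u) (rad u))))
      other : ht v ⊔ lev N (pos v) (pos u) ≡ join u v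
      other = cong₂ _⊔_ (sym (m≤n⇒m⊔n≡n u≤v)) (lev-sym N (pos v) (pos u))

  lower : Fin n → Fin n → ℕ
  lower u v with ht u ≤? ht v
  ... | yes _ = pos u
  ... | no  _ = pos v

  hops-lower : ∀ u v → hop-at (u , lower u v) + hop-at (v , lower u v) ≡ span nowhere u v
  hops-lower u v with ht u ≤? ht v
  ... | yes p = split-span u v p
  ... | no ¬p = trans (+-comm (hop-at (u , pos v)) (hop-at (v , pos v)))
    (trans (split-span v u (<⇒≤ (≰⇒> ¬p))) (span-sym nowhere v u))

  top-lower : ∀ u v → halve N (lower u v) ≡ 1
  top-lower u v with ht u ≤? ht v
  ... | yes _ = top u
  ... | no  _ = top v

  -- In the unplanted metric every edge is a shortest path through a terminal.
  halves : List (Edge n) → List HalfEdge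
  halves [] = []
  halves ((u , v) ∷ E) with u Fin.≟ v
  ... | yes _ = halves E
  ... | no  _ = (u , lower u v) ∷ (v , lower u v) ∷ halves E

  halves-cost : ∀ E → sum (map hop-at (halves E)) ≡ sum (map (λ e → dist nowhere (proj₁ e) (proj₂ e)) E)
  halves-cost [] = refl
  halves-cost ((u , v) ∷ E) with u Fin.≟ v
  ... | yes _ = halves-cost E
  ... | no  _ = trans (sym (+-assoc (hop-at (u , lower u v)) _ _)) (cong₂ _+_ (hops-lower u v) (halves-cost E))

  halves-top : ∀ E → All (λ p → halve N (proj₂ p) ≡ 1) (halves E)
  halves-top [] = []
  halves-top ((u , v) ∷ E) with u Fin.≟ v
  ... | yes _ = halves-top E
  ... | no  _ = top-lower u v ∷ top-lower u v ∷ halves-top E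

  halves-∈ : ∀ {u v} E → (u , v) ∈ E → u ≡ v ⊎ ∃ λ t → (u , t) ∈ halves E × (v , t) ∈ halves E
  halves-∈ {u} {v} (_ ∷ E) (here refl) with u Fin.≟ v
  ... | yes p = inj₁ p
  ... | no  _ = inj₂ (lower u v , here refl , there (here refl))
  halves-∈ ((a , b) ∷ E) (there m) with halves-∈ E m | a Fin.≟ b
  ... | inj₁ p           | _     = inj₁ p
  ... | inj₂ q           | yes _ = inj₂ q
  ... | inj₂ (t , p , q) | no  _ = inj₂ (t , there (there p) , there (there q))

  incident : Fin n → List HalfEdge → List ℕ
  incident v [] = []
  incident v ((u , t) ∷ hs) with v Fin.≟ u
  ... | yes _ = t ∷ incident v hs
  ... | no  _ = incident v hs

  incident-∈ : ∀ {v t} hs → (v , t) ∈ hs → t ∈ incident v hs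
  incident-∈ {v} (_ ∷ hs) (here refl) with v Fin.≟ v
  ... | yes _ = here refl
  ... | no ne = ⊥-elim (ne refl)
  incident-∈ {v} ((u , _) ∷ hs) (there m) with v Fin.≟ u
  ... | yes _ = there (incident-∈ hs m)
  ... | no  _ = incident-∈ hs m

  incident-All : ∀ {Q : ℕ → Set} v hs → All (λ p → Q (proj₂ p)) hs → All Q (incident v hs)
  incident-All v [] [] = []
  incident-All v ((u , t) ∷ hs) (q ∷ qs) with v Fin.≟ u
  ... | yes _ = q ∷ incident-All v hs qs
  ... | no  _ = incident-All v hs qs

  star-cost : List HalfEdge → Fin n → ℕ
  star-cost hs v = hops (pos v) (ht v) (incident v hs)

  private
    new-cost : HalfEdge → Fin n → ℕ
    new-cost (u , t) v with v Fin.≟ u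
    ... | yes _ = hop-at (u , t)
    ... | no  _ = 0

    star-cost-∷ : ∀ p hs v → star-cost (p ∷ hs) v ≡ new-cost p v + star-cost hs v
    star-cost-∷ (u , t) hs v with v Fin.≟ u
    ... | yes refl = refl
    ... | no  _    = refl

    new-cost-absent : ∀ u t vs → All (u ≢_) vs → sum (map (new-cost (u , t)) vs) ≡ 0
    new-cost-absent u t []       []        = refl
    new-cost-absent u t (v ∷ vs) (ne ∷ ns) with v Fin.≟ u
    ... | yes e = ⊥-elim (ne (sym e))
    ... | no  _ = new-cost-absent u t vs ns

    new-cost-total : ∀ u t vs → Unique vs → sum (map (new-cost (u , t)) vs) ≤ hop-at (u , t)
    new-cost-total u t []       _          = z≤n
    new-cost-total u t (v ∷ vs) (ns ∷ uniq) with v Fin.≟ u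
    ... | yes refl = ≤-reflexive (trans (cong (λ z → hop-at (u , t) + z) (new-cost-absent u t vs ns)) (+-identityʳ _))
    ... | no  _    = new-cost-total u t vs uniq

    sum-map-+ : ∀ {f g k : Fin n → ℕ} → (∀ v → k v ≡ f v + g v) → ∀ vs → sum (map k vs) ≡ sum (map f vs) + sum (map g vs)
    sum-map-+ eq [] = refl
    sum-map-+ {f} {g} eq (v ∷ vs) = trans (cong₂ _+_ (eq v) (sum-map-+ eq vs)) (e (f v) (g v) (sum (map f vs)) (sum (map g vs)))
      where
      e : ∀ a b c d → a + b + (c + d) ≡ a + c + (b + d)
      e = solve-∀

  star-costs : ∀ hs vs → Unique vs → sum (map (star-cost hs) vs) ≤ sum (map hop-at hs)
  star-costs [] vs uniq = ≤-reflexive (zeros vs)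
    where
    zeros : ∀ vs → sum (map (star-cost []) vs) ≡ 0
    zeros []       = refl
    zeros (v ∷ vs) = zeros vs
  star-costs (p ∷ hs) vs uniq = ≤-trans (≤-reflexive (sum-map-+ (star-cost-∷ p hs) vs))
    (+-mono-≤ (new-cost-total (proj₁ p) (proj₂ p) vs uniq) (star-costs hs vs uniq))

  module _ (E : List (Edge n)) where

    hs : List HalfEdge
    hs = halves E

    star-at : ∀ v → ∃ λ F → price F ≤ star-cost hs v × ∃ λ hub → (ht v ≡ 0 → hub ≡ pos v) × Attached F hub (incident v hs)
    star-at v = star (pos v) (ht v) (incident v hs) (ht≤H v)
      (All.map (λ e → trans (top v) (sym e)) (incident-All v hs (halves-top E)))

    links : List (Fin n) → List (ℕ × ℕ)
    links []       = []
    links (v ∷ vs) = proj₁ (star-at v) ++ links vs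

    links-price : ∀ vs → price (links vs) ≤ sum (map (star-cost hs) vs)
    links-price []       = z≤n
    links-price (v ∷ vs) = subst (_≤ star-cost hs v + sum (map (star-cost hs) vs)) (sym (price-++ (proj₁ (star-at v)) (links vs)))
      (+-mono-≤ (proj₁ (proj₂ (star-at v))) (links-price vs))

    -- Each vertex takes the label of the hub of its star. This extends a labelling of the leaves to
    -- all points, so that paths in the Steiner tree become equalities of labels.
    label : (ℕ → ℕ) → Fin n → ℕ
    label g v = g (proj₁ (proj₂ (proj₂ (star-at v))))

    links-attached : ∀ g vs → Constant g (links vs) → ∀ {v t} → v ∈ vs → (v , t) ∈ hs → g t ≡ label g v
    links-attached g (v ∷ vs) c (here refl) m = All.lookup
      (proj₂ (proj₂ (proj₂ (proj₂ (star-at v)))) g (All.++⁻ˡ (proj₁ (star-at v)) c)) (incident-∈ hs m)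
    links-attached g (v ∷ vs) c (there v∈) m = links-attached g vs (All.++⁻ʳ (proj₁ (star-at v)) c) v∈ m

    all-links : List (ℕ × ℕ)
    all-links = links (allFin n)

    label-edge : ∀ g → Constant g all-links → ∀ {u v} → (u , v) ∈ E → label g u ≡ label g v
    label-edge g c m with halves-∈ E m
    ... | inj₁ refl        = refl
    ... | inj₂ (t , p , q) = trans (sym (links-attached g (allFin n) c (∈-allFin _) p))
                                   (links-attached g (allFin n) c (∈-allFin _) q)

    label-path : ∀ g → Constant g all-links → ∀ {u v} → Path E u v → label g u ≡ label g v
    label-path g c here                = refl
    label-path g c (step (inj₁ m) p) = trans (label-edge g c m) (label-path g c p)
    label-path g c (step (inj₂ m) p) = trans (sym (label-edge g c m)) (label-path g c p)

  tree-bound : ∀ {k} → (∀ p → Leaf p → ∃ λ v → IsTerminal k v × pos v ≡ p × ht v ≡ 0) → (S : SteinerTree n k) →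
    (5 * H + 2) * 2 ^ H ≤ sum (map (λ e → dist nowhere (proj₁ e) (proj₂ e)) (edges S))
  tree-bound leaf S = begin
    (5 * H + 2) * 2 ^ H                      ≤⟨ SpanningValue.spans⇒price h (all-links E) spans ⟩
    price (all-links E)                      ≤⟨ links-price E (allFin n) ⟩
    sum (map (star-cost (halves E)) (allFin n)) ≤⟨ star-costs (halves E) (allFin n) (allFin⁺ n) ⟩
    sum (map hop-at (halves E))              ≡⟨ halves-cost E ⟩
    sum (map (λ e → dist nowhere (proj₁ e) (proj₂ e)) E) ∎
    where
    open ≤-Reasoning
    E = edges S
    label-leaf : ∀ g v → ht v ≡ 0 → label E g v ≡ g (pos v)
    label-leaf g v e = cong g (proj₁ (proj₂ (proj₂ (proj₂ (star-at E v)))) e)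
    spans : Spans (all-links E)
    spans g c {p} {q} Lp Lq with leaf p Lp | leaf q Lq
    ... | u , tu , refl , hu | v , tv , refl , hv = trans (sym (label-leaf g u hu))
      (trans (label-path E g c (connected S u v (terminals S u tu) (terminals S v tv))) (label-leaf g v hv))

-- Heap numbering of the hidden tree, and its length

⌊n/2⌋<n-pos : ∀ n → 1 ≤ n → ⌊ n /2⌋ < n
⌊n/2⌋<n-pos (suc n) _ = ⌊n/2⌋<n n

⌊log₂⌋-suc : ∀ g → 2 ≤ g → ⌊log₂ g ⌋ ≡ suc ⌊log₂ ⌊ g /2⌋ ⌋
⌊log₂⌋-suc g p = sym (trans (cong suc (⌊log₂⌊n/2⌋⌋≡⌊log₂n⌋∸1 g))
  (trans (+-comm 1 _) (m∸n+n≡m (subst (_≤ ⌊log₂ g ⌋) (⌊log₂[2^n]⌋≡n 1) (⌊log₂⌋-mono-≤ p)))))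

halve-log₂ : ∀ f g → 1 ≤ g → g ≤ f → halve ⌊log₂ g ⌋ g ≡ 1
halve-log₂ zero    g p q = ⊥-elim (<⇒≱ p q)
halve-log₂ (suc f) g p q with m≤n⇒m<n∨m≡n p
... | inj₂ refl = cong (λ z → halve z 1) (⌊log₂[2^n]⌋≡n 0)
... | inj₁ 2≤g  = begin
  halve ⌊log₂ g ⌋ g                       ≡⟨ cong (λ z → halve z g) (⌊log₂⌋-suc g 2≤g) ⟩
  halve (suc ⌊log₂ ⌊ g /2⌋ ⌋) g           ≡⟨ sym (halve-⌊/2⌋ ⌊log₂ ⌊ g /2⌋ ⌋ g) ⟩
  halve ⌊log₂ ⌊ g /2⌋ ⌋ ⌊ g /2⌋           ≡⟨ halve-log₂ f ⌊ g /2⌋ (⌊n/2⌋-mono 2≤g) (≤-pred (≤-trans (⌊n/2⌋<n-pos g p) q)) ⟩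
  1                                       ∎
  where open ≡-Reasoning

2^⌊log₂⌋≤ : ∀ g → 1 ≤ g → 2 ^ ⌊log₂ g ⌋ ≤ g
2^⌊log₂⌋≤ g p = subst (_≤ g) (trans (cong (_* 2 ^ ⌊log₂ g ⌋) (halve-log₂ g g p ≤-refl)) (*-identityˡ _))
  (halve*2^≤ ⌊log₂ g ⌋ g)

⌊log₂⌋-< : ∀ g d → 1 ≤ g → g < 2 ^ d → ⌊log₂ g ⌋ < d
⌊log₂⌋-< g d p lt with ⌊log₂ g ⌋ <? d
... | yes q = q
... | no ¬q = ⊥-elim (<⇒≱ lt (≤-trans (^-monoʳ-≤ 2 (≮⇒≥ ¬q)) (2^⌊log₂⌋≤ g p)))

⌊log₂⌋-≥ : ∀ g d → 2 ^ d ≤ g → d ≤ ⌊log₂ g ⌋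
⌊log₂⌋-≥ g d p = subst (_≤ ⌊log₂ g ⌋) (⌊log₂[2^n]⌋≡n d) (⌊log₂⌋-mono-≤ p)

⌊log₂⌋-≡ : ∀ g d → 2 ^ d ≤ g → g < 2 ^ suc d → ⌊log₂ g ⌋ ≡ d
⌊log₂⌋-≡ g d p q = ≤-antisym (≤-pred (⌊log₂⌋-< g (suc d) (≤-trans (m^n>0 2 d) p) q)) (⌊log₂⌋-≥ g d p)

-- Nodes of the hidden tree are numbered as in a binary heap, g having children 2g and 2g + 1; the leaves are
-- k, …, 2k − 1, and the root 1 is dropped in favour of an edge joining 2 and 3.
module Heap (h : ℕ) where
  open Heights h

  k : ℕ
  k = 2 ^ N

  Node : ℕ → Set
  Node g = 2 ≤ g × g < 2 * k

  height : ℕ → ℕ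
  height g = N ∸ ⌊log₂ g ⌋

  -- The leftmost leaf below `g`.
  place : ℕ → ℕ
  place g = g * 2 ^ height g

  log≤N : ∀ {g} → Node g → ⌊log₂ g ⌋ ≤ N
  log≤N {g} (p , q) = ≤-pred (⌊log₂⌋-< g (suc N) (≤-trans (s≤s z≤n) p) q)

  1≤log : ∀ {g} → Node g → 1 ≤ ⌊log₂ g ⌋
  1≤log {g} (p , q) = ⌊log₂⌋-≥ g 1 p

  height≤H : ∀ {g} → Node g → height g ≤ H
  height≤H nd = ∸-monoʳ-≤ N (1≤log nd)

  height-leaf : ∀ {g} → Node g → k ≤ g → height g ≡ 0
  height-leaf {g} nd p = m≤n⇒m∸n≡0 (⌊log₂⌋-≥ g N p)

  0<height : ∀ {g} → 1 ≤ g → g < k → 0 < height g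
  0<height {g} p q = m<n⇒0<n∸m (⌊log₂⌋-< g N p q)

  place-leaf : ∀ {g} → Node g → k ≤ g → place g ≡ g
  place-leaf {g} nd p = trans (cong (λ z → g * 2 ^ z) (height-leaf nd p)) (*-identityʳ g)

  place-top : ∀ {g} → Node g → halve N (place g) ≡ 1
  place-top {g} nd = begin
    halve N (place g)                              ≡⟨ cong (λ z → halve z (place g)) (sym (m+[n∸m]≡n (log≤N nd))) ⟩
    halve (⌊log₂ g ⌋ + height g) (place g)         ≡⟨ halve-+ ⌊log₂ g ⌋ (height g) (place g) ⟩
    halve ⌊log₂ g ⌋ (halve (height g) (place g))   ≡⟨ cong (halve ⌊log₂ g ⌋) (halve-*2^ (height g) g) ⟩
    halve ⌊log₂ g ⌋ g                              ≡⟨ halve-log₂ g g (≤-trans (s≤s z≤n) (proj₁ nd)) ≤-refl ⟩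
    1                                              ∎
    where open ≡-Reasoning

  meet : ℕ → ℕ → ℕ
  meet g g′ = height g ⊔ height g′ ⊔ lev N (place g) (place g′)

  private
    +<2* : ∀ {a b c} → a < c → b ≤ c → a + b < 2 * c
    +<2* {a} {b} {c} p q = subst (a + b <_) (cong (λ z → c + z) (sym (+-identityʳ c))) (+-mono-<-≤ p q)

  -- The meeting point is strictly above the lower node. At equal heights it is strictly above both,
  -- because positions that agree at the common height come from the same node.
  Radius-separated : ∀ {g g′} → Node g → Node g′ → g ≢ g′ →
    Radius (height g) + Radius (height g′) < 2 * Radius (meet g g′)
  Radius-separated {g} {g′} nd nd′ ne with <-cmp (height g) (height g′)
  ... | tri< lt _ _ = +<2* (<-≤-trans (Radius-< lt (m∸n≤m N ⌊log₂ g′ ⌋)) (Radius-mono b)) (Radius-mono b)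
    where
    b : height g′ ≤ meet g g′
    b = ≤-trans (m≤n⊔m (height g) (height g′)) (m≤m⊔n _ _)
  ... | tri> _ _ gt = subst (_< 2 * Radius (meet g g′)) (+-comm (Radius (height g′)) (Radius (height g)))
      (+<2* (<-≤-trans (Radius-< gt (m∸n≤m N ⌊log₂ g ⌋)) (Radius-mono b)) (Radius-mono b))
    where
    b : height g ≤ meet g g′
    b = ≤-trans (m≤m⊔n (height g) (height g′)) (m≤m⊔n _ _)
  ... | tri≈ _ eq _ = subst (λ z → Radius (height g) + Radius z < 2 * Radius (meet g g′)) eq
      (+<2* strict (<⇒≤ strict))
    where
    far : height g < lev N (place g) (place g′)
    far = ≰⇒> (λ le → ne (trans (sym (halve-*2^ (height g) g))
      (trans (lev-sound N (place g) (place g′) (height g) (trans (place-top nd) (sym (place-top nd′))) le)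
        (trans (cong (λ z → halve z (place g′)) eq) (halve-*2^ (height g′) g′)))))
    strict : Radius (height g) < Radius (meet g g′)
    strict = <-≤-trans (Radius-< far (lev≤ N _ _)) (Radius-mono (m≤n⊔m (height g ⊔ height g′) _))

  parent-height : ∀ {g} → Node g → height ⌊ g /2⌋ ≡ suc (height g)
  parent-height {g} nd = trans (+-∸-assoc 1 (subst (_≤ N) log-suc (log≤N nd))) (cong (λ z → suc (N ∸ z)) (sym log-suc))
    where
    log-suc : ⌊log₂ g ⌋ ≡ suc ⌊log₂ ⌊ g /2⌋ ⌋
    log-suc = ⌊log₂⌋-suc g (proj₁ nd)

  parent-meet : ∀ {g} → Node g → meet g ⌊ g /2⌋ ≤ suc (height g)
  parent-meet {g} nd = ⊔-lub (⊔-lub (n≤1+n _) (≤-reflexive (parent-height nd)))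
    (lev-least N (place g) (place ⌊ g /2⌋) (suc (height g))
      (trans (cong ⌊_/2⌋ (halve-*2^ (height g) g))
        (sym (trans (cong (λ z → halve z (place ⌊ g /2⌋)) (sym (parent-height nd))) (halve-*2^ (height ⌊ g /2⌋) ⌊ g /2⌋)))))

  edge-length : ℕ → ℕ
  edge-length j = Radius (suc j) ∸ Radius j

  -- The 2^(2+e) nodes of depth 2 + e have height H - (e + 1), and each has one edge to its parent.
  level-length : ℕ → ℕ
  level-length e = 2 ^ (2 + e) * edge-length (H ∸ suc e)

module HeapLength where
  open Heights
  open Heap

  private
    double : ∀ p → 6 * (2 * p) ∸ 6 * p ≡ 6 * p
    double p = trans (cong (λ z → z ∸ 6 * p) (e p)) (m+n∸n≡m (6 * p) (6 * p))
      where
      e : ∀ p → 6 * (2 * p) ≡ 6 * p + 6 * p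
      e = solve-∀

    edge-low : ∀ h i → suc i ≤ H h → edge-length h i ≡ radius (suc i) ∸ radius i
    edge-low h i p = cong₂ _∸_ (Radius-low h p) (Radius-low h (<⇒≤ p))

    -- Away from the bottom the edge length doubles with the height while the number of nodes
    -- halves.
    high-level : ∀ h e → e < h → level-length (suc h) e ≡ 3 * 2 ^ H (suc h)
    high-level h e lt = begin
      2 ^ (2 + e) * edge-length (suc h) (2 + h ∸ suc e) ≡⟨ cong (λ z → 2 ^ (2 + e) * edge-length (suc h) z) (+-∸-assoc 2 lt) ⟩
      2 ^ (2 + e) * edge-length (suc h) (2 + i)         ≡⟨ cong (λ z → 2 ^ (2 + e) * z) (trans (edge-low (suc h) (2 + i) i<h) (double (2 ^ i))) ⟩
      2 ^ (2 + e) * (6 * 2 ^ i)                         ≡⟨ e′ (2 ^ (2 + e)) (2 ^ i) ⟩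
      3 * (2 ^ (2 + e) * 2 ^ suc i)                     ≡⟨ cong (3 *_) (sym (^-distribˡ-+-* 2 (2 + e) (suc i))) ⟩
      3 * 2 ^ (2 + e + suc i)                           ≡⟨ cong (λ z → 3 * 2 ^ (2 + z)) (trans (+-suc e i) (m+[n∸m]≡n lt)) ⟩
      3 * 2 ^ H (suc h)                                 ∎
      where
      open ≡-Reasoning
      i = h ∸ suc e
      i<h : 3 + i ≤ H (suc h)
      i<h = s≤s (s≤s (subst (_≤ h) (+-∸-assoc 1 lt) (m∸n≤m h e)))
      e′ : ∀ a b → a * (6 * b) ≡ 3 * (a * (2 * b))
      e′ = solve-∀

    high-levels : ∀ h M → M ≤ h → ∑< M (level-length (suc h)) ≡ 3 * M * 2 ^ H (suc h)
    high-levels h zero    _ = refl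
    high-levels h (suc M) p = trans (cong₂ _+_ (high-levels h M (<⇒≤ p)) (high-level h M p)) (e M (2 ^ H (suc h)))
      where
      e : ∀ m p → 3 * m * p + 3 * p ≡ 3 * suc m * p
      e = solve-∀

  top-length : ℕ → ℕ
  top-length h = 2 * Radius h (N h) ∸ 2 * Radius h (H h)

  -- In units of 2^H and for H ≥ 2: 4 for each of the two lowest levels, 3 for each of the H - 2
  -- others, and 1 for the edge that replaces the root.
  total-length : ∀ h → ∑< (H h) (level-length h) + top-length h ≡ 3 * N h * 2 ^ H h
  total-length zero rewrite edge-low 0 0 ≤-refl | Radius-low 0 {1} ≤-refl | Radius-top 0 {2} ≤-refl = refl
  total-length (suc h) = begin
    ∑< h (level-length (suc h)) + level-length (suc h) h + level-length (suc h) (suc h) + top-length (suc h)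
      ≡⟨ cong₂ _+_ (cong₂ _+_ (cong₂ _+_ (high-levels h h ≤-refl) second) first) top ⟩
    3 * h * (2 * (2 * p)) + 2 * (2 * p) * 4 + 2 * (2 * (2 * p)) * 2 + 4 * p
      ≡⟨ e h p ⟩
    3 * (3 + h) * (2 * (2 * p)) ∎
    where
    open ≡-Reasoning
    p = 2 ^ h
    second : level-length (suc h) h ≡ 2 * (2 * p) * 4
    second = cong (λ z → 2 * (2 * p) * z)
      (trans (cong (edge-length (suc h)) (m+n∸n≡m 1 h)) (edge-low (suc h) 1 (s≤s (s≤s z≤n))))
    first : level-length (suc h) (suc h) ≡ 2 * (2 * (2 * p)) * 2
    first = cong (λ z → 2 * (2 * (2 * p)) * z)
      (trans (cong (edge-length (suc h)) (n∸n≡0 h)) (edge-low (suc h) 0 (s≤s z≤n)))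
    top : top-length (suc h) ≡ 4 * p
    top = trans (cong₂ (λ a b → 2 * a ∸ 2 * b) (Radius-top (suc h) ≤-refl) (Radius-low (suc h) ≤-refl))
      (trans (cong (λ z → z ∸ 2 * (6 * p)) (lem p)) (m+n∸n≡m (4 * p) (2 * (6 * p))))
      where
      lem : ∀ p → 2 * (2 * (2 * (2 * p))) ≡ 4 * p + 2 * (6 * p)
      lem = solve-∀
    e : ∀ h p → 3 * h * (2 * (2 * p)) + 2 * (2 * p) * 4 + 2 * (2 * (2 * p)) * 2 + 4 * p ≡ 3 * (3 + h) * (2 * (2 * p))
    e = solve-∀

-- The planted instances and their cheap Steiner tree

sum-applyUpTo : ∀ (f : ℕ → ℕ) n → sum (applyUpTo f n) ≡ ∑< n f
sum-applyUpTo f zero    = refl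
sum-applyUpTo f (suc n) = begin
  sum (applyUpTo f (suc n))          ≡⟨ cong sum (sym (applyUpTo-∷ʳ f n)) ⟩
  sum (applyUpTo f n ++ f n ∷ [])    ≡⟨ sum-++ (applyUpTo f n) (f n ∷ []) ⟩
  sum (applyUpTo f n) + (f n + 0)    ≡⟨ cong₂ _+_ (sum-applyUpTo f n) (+-identityʳ (f n)) ⟩
  ∑< n f + f n                       ∎
  where open ≡-Reasoning

∑<-split : ∀ a b f → ∑< (a + b) f ≡ ∑< a f + ∑< b (λ i → f (a + i))
∑<-split a zero    f = trans (cong (λ z → ∑< z f) (+-identityʳ a)) (sym (+-identityʳ _))
∑<-split a (suc b) f = trans (cong (λ z → ∑< z f) (+-suc a b))
  (trans (cong (λ z → z + f (a + b)) (∑<-split a b f)) (+-assoc (∑< a f) _ (f (a + b))))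

∑<-const : ∀ n f c → (∀ i → i < n → f i ≤ c) → ∑< n f ≤ n * c
∑<-const zero    f c le = z≤n
∑<-const (suc n) f c le = ≤-trans (+-mono-≤ (∑<-const n f c (λ i p → le i (m≤n⇒m≤1+n p))) (le n ≤-refl))
  (≤-reflexive (+-comm (n * c) c))

Path-++ : ∀ {n} {E : List (Edge n)} {u v x} → Path E u v → Path E v x → Path E u x
Path-++ here       q = q
Path-++ (step e p) q = step e (Path-++ p q)

Path-reverse : ∀ {n} {E : List (Edge n)} {u v} → Path E u v → Path E v u
Path-reverse here              = here
Path-reverse (step (inj₁ e) p) = Path-++ (Path-reverse p) (step (inj₂ e) here)
Path-reverse (step (inj₂ e) p) = Path-++ (Path-reverse p) (step (inj₁ e) here)

does-true : ∀ {A : Set} (d : Dec A) → does d ≡ true → A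
does-true (yes p) _  = p
does-true (no _)  ()

module Planted (h n m : ℕ) (fits : suc m * 2 ^ suc (suc h) ≤ n) where
  open Heights h
  open Heap h

  private instance
    k≢0 : NonZero k
    k≢0 = m^n≢0 2 N

  2<k : 2 < k
  2<k = ≤-trans (s≤s (s≤s (s≤s z≤n))) (^-monoʳ-≤ 2 {2} {N} (s≤s (s≤s z≤n)))

  0<n : 0 < n
  0<n = ≤-trans (m^n>0 2 N) (≤-trans (m≤m+n k (m * k)) fits)

  -- The node that a point represents. The first `k` points are the leaves; the others are grouped
  -- by residue modulo `k`, and the residues 0 and 1, which number no node, are added to group 2.
  ident : Fin n → ℕ
  ident v with Fin.toℕ v <? k
  ... | yes _ = k + Fin.toℕ v
  ... | no  _ = 2 ⊔ Fin.toℕ v ND.% k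

  ident-terminal : ∀ v → Fin.toℕ v < k → ident v ≡ k + Fin.toℕ v
  ident-terminal v p with Fin.toℕ v <? k
  ... | yes _ = refl
  ... | no ¬p = ⊥-elim (¬p p)

  ident-hidden : ∀ v → k ≤ Fin.toℕ v → ident v ≡ 2 ⊔ Fin.toℕ v ND.% k
  ident-hidden v p with Fin.toℕ v <? k
  ... | yes q = ⊥-elim (<⇒≱ q p)
  ... | no  _ = refl

  ident-hidden< : ∀ v → k ≤ Fin.toℕ v → ident v < k
  ident-hidden< v p = subst (_< k) (sym (ident-hidden v p)) (⊔-lub 2<k (ND.m%n<n (Fin.toℕ v) k))

  k<2k : ∀ {x} → x < k → k + x < 2 * k
  k<2k {x} p = subst (k + x <_) (cong (λ z → k + z) (sym (+-identityʳ k))) (+-monoʳ-< k p)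

  ident-node : ∀ v → Node (ident v)
  ident-node v with Fin.toℕ v <? k
  ... | yes p = ≤-trans (<⇒≤ 2<k) (m≤m+n k _) , k<2k p
  ... | no  _ = m≤m⊔n 2 (Fin.toℕ v ND.% k) , <-≤-trans (⊔-lub 2<k (ND.m%n<n (Fin.toℕ v) k)) (m≤m+n k _)

  ident-injective-terminal : ∀ u v → Fin.toℕ u < k → ident u ≡ ident v → u ≡ v
  ident-injective-terminal u v p e with Fin.toℕ v <? k in eq
  ... | yes q = Fin.toℕ-injective (+-cancelˡ-≡ k _ _ (trans (sym (ident-terminal u p)) e))
  ... | no ¬q = ⊥-elim (<⇒≱ (⊔-lub 2<k (ND.m%n<n (Fin.toℕ v) k))
      (subst (k ≤_) (trans (sym (ident-terminal u p)) e) (m≤m+n k _)))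

  pos ht : Fin n → ℕ
  pos v = place (ident v)
  ht v  = height (ident v)

  open Points h pos ht public
  open Unplanted h pos ht (λ v → height≤H (ident-node v)) (λ v → place-top (ident-node v)) public using (nowhere; tree-bound)

  0<rad : ∀ v → k ≤ Fin.toℕ v → 0 < rad v
  0<rad v p = ≤-trans (s≤s z≤n) (Radius-< {0} {ht v}
    (0<height (≤-trans (s≤s z≤n) (proj₁ (ident-node v))) (ident-hidden< v p)) (m∸n≤m N ⌊log₂ ident v ⌋))

  -- Points of different nodes are apart in the tree already. Two points of one node are both
  -- hidden, hence of positive radius, and since not both are planted the detour separates them.
  separated : ∀ P → (∀ u v → P u ≡ true → P v ≡ true → ident u ≡ ident v → u ≡ v) → Separated P
  separated P unique u v ne with ident u ≟ ident v
  ... | no ne′ = inj₁ (Radius-separated (ident-node u) (ident-node v) ne′)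
  ... | yes e with dichotomy (P u ∧ P v)
  ...   | inj₁ both = ⊥-elim (ne (unique u v (∧-true both) (∧-true (trans (∧-comm (P v) (P u)) both)) e))
    where
    ∧-true : ∀ {a b} → a ∧ b ≡ true → a ≡ true
    ∧-true {true} _ = refl
  ...   | inj₂ notboth = inj₂ (subst (λ b → 0 < (if b then 0 else rad u ⊓ rad v)) (sym notboth)
          (⊓-glb (0<rad u (≮⇒≥ (λ p → ne (ident-injective-terminal u v p e))))
                 (0<rad v (≮⇒≥ (λ p → ne (sym (ident-injective-terminal v u p (sym e))))))))

  -- Group `g` has one candidate in each block of `k` consecutive points. Block 0 holds the
  -- terminals, so choice `s g` stands in block s g + 1.
  planted : (ℕ → ℕ) → Fin n → Bool
  planted s v = does (Fin.toℕ v ≟ ident v + suc (s (ident v)) * k)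

  planted-true : ∀ s v → planted s v ≡ true → Fin.toℕ v ≡ ident v + suc (s (ident v)) * k
  planted-true s v = does-true (Fin.toℕ v ≟ ident v + suc (s (ident v)) * k)

  M₀ : Metric n
  M₀ = metric nowhere (separated nowhere (λ u v ()))

  M : (ℕ → ℕ) → Metric n
  M s = metric (planted s) (separated (planted s) λ u v p q e → Fin.toℕ-injective
    (trans (planted-true s u p) (trans (cong (λ z → z + suc (s z) * k) e) (sym (planted-true s v q)))))

  dist-agree : ∀ P u v → P u ∧ P v ≡ false → dist P u v ≡ dist nowhere u v
  dist-agree P u v e with u Fin.≟ v
  ... | yes _ = refl
  ... | no  _ = cong (λ b → 2 * U u v ∸ (rad u + rad v) + 2 * (if b then 0 else rad u ⊓ rad v)) e

  unplanted-bound : (S : SteinerTree n k) → ⟦ (5 * H + 2) * 2 ^ H ⟧ ℚ.≤ cost M₀ S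
  unplanted-bound S = subst (⟦ (5 * H + 2) * 2 ^ H ⟧ ℚ.≤_) (sym (sumℚ-⟦⟧ (λ e → dist nowhere (proj₁ e) (proj₂ e)) (edges S)))
    (⟦⟧-mono (tree-bound leaf S))
    where
    leaf : ∀ p → Spanning.Leaf h p → ∃ λ v → IsTerminal k v × pos v ≡ p × ht v ≡ 0
    leaf p (k≤p , p<2k) = v , v<k , trans (cong place id≡p) (place-leaf nd k≤p) , trans (cong height id≡p) (height-leaf nd k≤p)
      where
      p∸k<k : p ∸ k < k
      p∸k<k = +-cancelˡ-< k (p ∸ k) k (subst₂ _<_ (sym (m+[n∸m]≡n k≤p)) (cong (λ z → k + z) (+-identityʳ k)) p<2k)
      lt : p ∸ k < n
      lt = <-≤-trans p∸k<k (≤-trans (m≤m+n k (m * k)) fits)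
      v : Fin n
      v = Fin.fromℕ< lt
      v<k : Fin.toℕ v < k
      v<k = subst (_< k) (sym (Fin.toℕ-fromℕ< lt)) p∸k<k
      id≡p : ident v ≡ p
      id≡p = trans (ident-terminal v v<k) (trans (cong (λ z → k + z) (Fin.toℕ-fromℕ< lt)) (m+[n∸m]≡n k≤p))
      nd : Node p
      nd = ≤-trans (<⇒≤ 2<k) k≤p , p<2k

  module Tree (s : ℕ → ℕ) (s<m : ∀ i → s i < m) where

    number : ℕ → ℕ
    number g with g <? k
    ... | yes _ = g + suc (s g) * k
    ... | no  _ = g ∸ k

    number<n : ∀ {g} → Node g → number g < n
    number<n {g} (_ , p) with g <? k
    ... | yes q = <-≤-trans (+-mono-<-≤ q (*-monoˡ-≤ k (s<m g))) fits
    ... | no ¬q = ≤-trans (+-cancelˡ-< k (g ∸ k) k (subst₂ _<_ (sym (m+[n∸m]≡n (≮⇒≥ ¬q))) (cong (λ z → k + z) (+-identityʳ k)) p))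
        (≤-trans (m≤m+n k (m * k)) fits)

    vertex : ℕ → Fin n
    vertex g with number g <? n
    ... | yes p = Fin.fromℕ< p
    -- A junk value that makes `vertex` total; for nodes `number<n` rules this case out.
    ... | no  _ = Fin.fromℕ< 0<n

    toℕ-vertex : ∀ {g} → Node g → Fin.toℕ (vertex g) ≡ number g
    toℕ-vertex {g} nd with number g <? n
    ... | yes p = Fin.toℕ-fromℕ< p
    ... | no ¬p = ⊥-elim (¬p (number<n nd))

    number-hidden : ∀ {g} → g < k → number g ≡ g + suc (s g) * k
    number-hidden {g} p with g <? k
    ... | yes _ = refl
    ... | no ¬p = ⊥-elim (¬p p)

    number-leaf : ∀ {g} → k ≤ g → number g ≡ g ∸ k
    number-leaf {g} p with g <? k
    ... | yes q = ⊥-elim (<⇒≱ q p)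
    ... | no  _ = refl

    ident-vertex : ∀ {g} → Node g → ident (vertex g) ≡ g
    ident-vertex {g} nd with <-≤-connex g k
    ... | inj₁ p = begin
        ident (vertex g)                    ≡⟨ ident-hidden (vertex g) (subst (k ≤_) (sym eq) (≤-trans (m≤m+n k _) (m≤n+m _ g))) ⟩
        2 ⊔ Fin.toℕ (vertex g) ND.% k       ≡⟨ cong (λ z → 2 ⊔ z ND.% k) eq ⟩
        2 ⊔ (g + suc (s g) * k) ND.% k      ≡⟨ cong (2 ⊔_) (trans (ND.[m+kn]%n≡m%n g (suc (s g)) k) (ND.m<n⇒m%n≡m p)) ⟩
        2 ⊔ g                               ≡⟨ m≤n⇒m⊔n≡n (proj₁ nd) ⟩
        g                                   ∎
      where
      open ≡-Reasoning
      eq : Fin.toℕ (vertex g) ≡ g + suc (s g) * k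
      eq = trans (toℕ-vertex nd) (number-hidden p)
    ... | inj₂ p = trans (ident-terminal (vertex g) (subst (_< k) (sym eq)
          (+-cancelˡ-< k (g ∸ k) k (subst₂ _<_ (sym (m+[n∸m]≡n p)) (cong (λ z → k + z) (+-identityʳ k)) (proj₂ nd)))))
        (trans (cong (λ z → k + z) eq) (m+[n∸m]≡n p))
      where
      eq : Fin.toℕ (vertex g) ≡ g ∸ k
      eq = trans (toℕ-vertex nd) (number-leaf p)

    vertex-planted : ∀ {g} → Node g → g < k → planted s (vertex g) ≡ true
    vertex-planted {g} nd p = dec-true (Fin.toℕ (vertex g) ≟ _) (trans (toℕ-vertex nd)
      (trans (number-hidden p) (sym (cong (λ z → z + suc (s z) * k) (ident-vertex nd)))))

    -- Either both endpoints are planted, or `g` is a leaf and has radius 0.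
    no-detour : ∀ {g g′} → Node g → Node g′ → g′ < k → detour (planted s) (vertex g) (vertex g′) ≡ 0
    no-detour {g} {g′} nd nd′ p′ with <-≤-connex g k
    ... | inj₁ p = cong₂ (λ a b → if a ∧ b then 0 else rad (vertex g) ⊓ rad (vertex g′)) (vertex-planted nd p) (vertex-planted nd′ p′)
    ... | inj₂ p = n≤0⇒n≡0 (≤-trans (detour≤ (planted s) (vertex g) (vertex g′)) (≤-trans (m⊓n≤m _ _)
      (≤-reflexive (trans (cong Radius (trans (cong height (ident-vertex nd)) (height-leaf nd p))) (Radius-low z≤n)))))

    tree-dist : ∀ {g g′} → Node g → Node g′ → g′ < k → g ≢ g′ →
      dist (planted s) (vertex g) (vertex g′) ≡ 2 * Radius (meet g g′) ∸ (Radius (height g) + Radius (height g′))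
    tree-dist {g} {g′} nd nd′ p ne = trans (dist-≢ (planted s) (λ e → ne (trans (sym (ident-vertex nd)) (trans (cong ident e) (ident-vertex nd′)))))
      (trans (cong₂ _+_ (cong₂ (λ a b → 2 * Radius (meet a b) ∸ (Radius (height a) + Radius (height b))) (ident-vertex nd) (ident-vertex nd′))
        (cong (2 *_) (no-detour nd nd′ p))) (+-identityʳ _))

    halve-node : ∀ {g} → Node g → 4 ≤ g → Node ⌊ g /2⌋ × ⌊ g /2⌋ < k
    halve-node {g} (_ , q) p = (⌊n/2⌋-mono p , <-≤-trans lt (m≤m+n k _)) , lt
      where
      lt : ⌊ g /2⌋ < k
      lt = *-cancelˡ-< 2 ⌊ g /2⌋ k (≤-<-trans (2*⌊n/2⌋≤n g) q)

    parent-dist : ∀ {g} → Node g → 4 ≤ g → dist (planted s) (vertex g) (vertex ⌊ g /2⌋) ≤ edge-length (height g)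
    parent-dist {g} nd p = begin
      dist (planted s) (vertex g) (vertex ⌊ g /2⌋)                             ≡⟨ tree-dist nd (proj₁ (halve-node nd p)) (proj₂ (halve-node nd p)) ne ⟩
      2 * Radius (meet g ⌊ g /2⌋) ∸ (Radius (height g) + Radius (height ⌊ g /2⌋)) ≤⟨ ∸-monoˡ-≤ (R + Radius (height ⌊ g /2⌋)) (*-monoʳ-≤ 2 (Radius-mono (parent-meet nd))) ⟩
      2 * R′ ∸ (R + Radius (height ⌊ g /2⌋))                                   ≡⟨ cong (λ z → 2 * R′ ∸ (R + Radius z)) (parent-height nd) ⟩
      2 * R′ ∸ (R + R′)                                                        ≡⟨ cong₂ _∸_ (cong (λ z → R′ + z) (+-identityʳ R′)) (+-comm R R′) ⟩
      R′ + R′ ∸ (R′ + R)                                                       ≡⟨ [m+n]∸[m+o]≡n∸o R′ R′ R ⟩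
      R′ ∸ R                                                                   ∎
      where
      open ≤-Reasoning
      R R′ : ℕ
      R  = Radius (height g)
      R′ = Radius (suc (height g))
      ne : g ≢ ⌊ g /2⌋
      ne e = <⇒≢ (⌊n/2⌋<n-pos g (≤-trans (s≤s z≤n) p)) (sym e)

    -- The number of nodes from 4 up to, but not including, 2^(2+e); each contributes the edge to
    -- its parent.
    count : ℕ → ℕ
    count zero    = 0
    count (suc e) = count e + 2 ^ (2 + e)

    4+count : ∀ e → 4 + count e ≡ 2 ^ (2 + e)
    4+count zero    = refl
    4+count (suc e) = trans (cong (λ z → z + 2 ^ (2 + e)) (4+count e)) (cong (λ z → 2 ^ (2 + e) + z) (sym (+-identityʳ _)))

    node₂₊ : ∀ {i} → i < 2 + count H → Node (2 + i)
    node₂₊ {i} p = s≤s (s≤s z≤n) , subst (2 + i <_) (4+count H) (+-monoʳ-< 2 p)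

    node₄₊ : ∀ {i} → i < count H → Node (4 + i)
    node₄₊ p = node₂₊ (s≤s (s≤s p))

    step-length : ℕ → ℕ
    step-length i = dist (planted s) (vertex (4 + i)) (vertex ⌊ 4 + i /2⌋)

    levels-length : ∀ e → e ≤ H → ∑< (count e) step-length ≤ ∑< e level-length
    levels-length zero    _ = z≤n
    levels-length (suc e) p = subst (_≤ ∑< (suc e) level-length) (sym (∑<-split (count e) (2 ^ (2 + e)) step-length))
      (+-mono-≤ (levels-length e (<⇒≤ p)) (∑<-const (2 ^ (2 + e)) _ _ bound))
      where
      bound : ∀ i → i < 2 ^ (2 + e) → step-length (count e + i) ≤ edge-length (H ∸ suc e)
      bound i lt = subst (λ z → step-length (count e + i) ≤ edge-length z) (cong (N ∸_) level)
        (parent-dist nd (s≤s (s≤s (s≤s (s≤s z≤n)))))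
        where
        g = 4 + (count e + i)
        g≡ : g ≡ 2 ^ (2 + e) + i
        g≡ = cong (λ z → z + i) (4+count e)
        g< : g < 2 ^ (3 + e)
        g< = subst₂ _<_ (sym g≡) (cong (λ z → 2 ^ (2 + e) + z) (sym (+-identityʳ _))) (+-monoʳ-< (2 ^ (2 + e)) lt)
        nd : Node g
        nd = s≤s (s≤s z≤n) , <-≤-trans g< (^-monoʳ-≤ 2 {3 + e} {suc N} (s≤s (s≤s p)))
        level : ⌊log₂ g ⌋ ≡ 2 + e
        level = ⌊log₂⌋-≡ g (2 + e) (subst (2 ^ (2 + e) ≤_) (sym g≡) (m≤m+n _ i)) g<

    node-2 : Node 2
    node-2 = node₂₊ (s≤s z≤n)

    node-3 : Node 3
    node-3 = node₂₊ (s≤s (s≤s z≤n))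

    -- Nodes 2 and 3 would meet at the dropped root of height `N`; their edge runs up to it and down
    -- again.
    top-dist : dist (planted s) (vertex 2) (vertex 3) ≤ HeapLength.top-length h
    top-dist = ≤-trans (≤-reflexive (tree-dist node-2 node-3 3<k (λ ())))
      (∸-mono (*-monoʳ-≤ 2 (Radius-mono (⊔-lub (⊔-lub (m∸n≤m N ⌊log₂ 2 ⌋) (m∸n≤m N ⌊log₂ 3 ⌋)) (lev≤ N _ _))))
        (≤-reflexive (trans (cong (λ z → Radius H + z) (+-identityʳ _))
          (cong₂ (λ a b → Radius (N ∸ a) + Radius (N ∸ b)) (sym (⌊log₂⌋-≡ 2 1 ≤-refl (s≤s (s≤s (s≤s z≤n)))))
             (sym (⌊log₂⌋-≡ 3 1 (s≤s (s≤s z≤n)) ≤-refl))))))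
      where
      3<k : 3 < k
      3<k = ^-monoʳ-≤ 2 {2} {N} (s≤s (s≤s z≤n))

    tree-edge : ℕ → Edge n
    tree-edge i = vertex (4 + i) , vertex ⌊ 4 + i /2⌋

    tree-verts : List (Fin n)
    tree-verts = applyUpTo (λ i → vertex (2 + i)) (2 + count H)

    tree-edges : List (Edge n)
    tree-edges = (vertex 2 , vertex 3) ∷ applyUpTo tree-edge (count H)

    vertex-∈ : ∀ {g} → Node g → vertex g ∈ tree-verts
    vertex-∈ {suc (suc i)} (s≤s (s≤s _) , p) =
      ∈-applyUpTo⁺ (λ i → vertex (2 + i)) (+-cancelˡ-< 2 i (2 + count H) (subst (2 + i <_) (sym (4+count H)) p))

    -- Passing to parents ends at 2 or 3; `f` bounds the number of steps, as ⌊g/2⌋ is not a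
    -- structural part of `g`.
    to-2 : ∀ f g → g ≤ f → Node g → Path tree-edges (vertex g) (vertex 2)
    to-2 f 0 _ (() , _)
    to-2 f 1 _ (s≤s () , _)
    to-2 f 2 _ _ = here
    to-2 f 3 _ _ = step (inj₂ (here refl)) here
    to-2 (suc f) g@(suc (suc (suc (suc i)))) (s≤s le) nd = step
      (inj₁ (there (∈-applyUpTo⁺ tree-edge (+-cancelˡ-< 4 i (count H) (subst (4 + i <_) (sym (4+count H)) (proj₂ nd))))))
      (to-2 f ⌊ g /2⌋ (≤-trans (s≤s (s≤s (⌊n/2⌋≤n i))) (≤-trans (n≤1+n _) le))
        (proj₁ (halve-node nd (s≤s (s≤s (s≤s (s≤s z≤n)))))))

    tree : SteinerTree n k
    tree = record
      { verts     = tree-verts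
      ; edges     = tree-edges
      ; uniq      = AllPairs.applyUpTo⁺₁ (λ i → vertex (2 + i)) (2 + count H) (λ {i} {j} i<j j< e →
          <⇒≢ i<j (+-cancelˡ-≡ 2 i j (trans (sym (ident-vertex (node₂₊ (<-trans i<j j<)))) (trans (cong ident e) (ident-vertex (node₂₊ j<))))))
      ; edges-in  = (vertex-∈ node-2 , vertex-∈ node-3) ∷ All.applyUpTo⁺₁ tree-edge (count H) (λ {i} p →
          vertex-∈ (node₄₊ p) , vertex-∈ (proj₁ (halve-node (node₄₊ p) (s≤s (s≤s (s≤s (s≤s z≤n)))))))
      ; size      = trans (+-comm _ 1) (cong (λ z → 2 + z) (trans (length-applyUpTo tree-edge (count H))
          (sym (length-applyUpTo (λ i → vertex (4 + i)) (count H)))))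
      ; connected = λ u v u∈ v∈ → Path-++ (to-root u∈) (Path-reverse (to-root v∈))
      ; terminals = λ t t<k → subst (_∈ tree-verts) (terminal t t<k) (vertex-∈ (leaf t<k))
      }
      where
      to-root : ∀ {u} → u ∈ tree-verts → Path tree-edges u (vertex 2)
      to-root u∈ with ∈-applyUpTo⁻ (λ i → vertex (2 + i)) u∈
      ... | i , i< , refl = to-2 (2 + i) (2 + i) ≤-refl (node₂₊ i<)
      leaf : ∀ {x} → x < k → Node (k + x)
      leaf p = ≤-trans (<⇒≤ 2<k) (m≤m+n k _) , k<2k p
      terminal : ∀ t → Fin.toℕ t < k → vertex (k + Fin.toℕ t) ≡ t
      terminal t p = Fin.toℕ-injective (trans (toℕ-vertex (leaf p)) (trans (number-leaf (m≤m+n k _)) (m+n∸m≡n k _)))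

    tree-cost : cost (M s) tree ℚ.≤ ⟦ 3 * N * 2 ^ H ⟧
    tree-cost = subst (ℚ._≤ ⟦ 3 * N * 2 ^ H ⟧) (sym (sumℚ-⟦⟧ d tree-edges)) (⟦⟧-mono (begin
      d (vertex 2 , vertex 3) + sum (map d (applyUpTo tree-edge (count H)))
        ≡⟨ cong (λ z → d (vertex 2 , vertex 3) + z) (trans (cong sum (map-applyUpTo tree-edge d (count H))) (sum-applyUpTo step-length (count H))) ⟩
      d (vertex 2 , vertex 3) + ∑< (count H) step-length
        ≤⟨ +-mono-≤ top-dist (levels-length H ≤-refl) ⟩
      HeapLength.top-length h + ∑< H level-length
        ≡⟨ trans (+-comm (HeapLength.top-length h) _) (HeapLength.total-length h) ⟩
      3 * N * 2 ^ H ∎))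
      where
      open ≤-Reasoning
      d : Edge n → ℕ
      d e = dist (planted s) (proj₁ e) (proj₂ e)

-- Counting the choices of planted points

infixr 5 _◂_
_◂_ : ℕ → (ℕ → ℕ) → ℕ → ℕ
(x ◂ s) zero    = x
(x ◂ s) (suc i) = s i

[_≟_] : ℕ → ℕ → ℕ
[ x ≟ a ] = if does (x ≟ a) then 1 else 0

[≟]-yes : ∀ {x a} → x ≡ a → [ x ≟ a ] ≡ 1
[≟]-yes {x} {a} e = cong (λ b → if b then 1 else 0) (dec-true (x ≟ a) e)

[≟]-no : ∀ {x a} → x ≢ a → [ x ≟ a ] ≡ 0
[≟]-no {x} {a} ne = cong (λ b → if b then 1 else 0) (dec-false (x ≟ a) ne)

∑<-*ˡ : ∀ c n f → c * ∑< n f ≡ ∑< n (λ i → c * f i)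
∑<-*ˡ c zero    f = *-zeroʳ c
∑<-*ˡ c (suc n) f = trans (*-distribˡ-+ c (∑< n f) (f n)) (cong (λ z → z + c * f n) (∑<-*ˡ c n f))

∑<-*ʳ : ∀ c n f → ∑< n (λ i → f i * c) ≡ ∑< n f * c
∑<-*ʳ c n f = trans (∑<-cong n (λ i → *-comm (f i) c)) (trans (sym (∑<-*ˡ c n f)) (*-comm c (∑< n f)))

∑<-[≟]-outside : ∀ a M → M ≤ a → ∑< M (λ x → [ x ≟ a ]) ≡ 0
∑<-[≟]-outside a zero    _ = refl
∑<-[≟]-outside a (suc M) p = cong₂ _+_ (∑<-[≟]-outside a M (<⇒≤ p)) ([≟]-no (<⇒≢ p))

∑<-[≟] : ∀ a M → ∑< M (λ x → [ x ≟ a ]) ≤ 1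
∑<-[≟] a zero = z≤n
∑<-[≟] a (suc M) with M ≟ a
... | yes refl = ≤-reflexive (cong₂ _+_ (∑<-[≟]-outside a a ≤-refl) ([≟]-yes {a} refl))
... | no ne    = subst (_≤ 1) (sym (trans (cong (λ z → ∑< M (λ x → [ x ≟ a ]) + z) ([≟]-no ne)) (+-identityʳ _))) (∑<-[≟] a M)

-- ∑ˢ sums over all s with s i < m for i < L and s i = 0 beyond.
module Sequences (m : ℕ) where

  ∑ˢ : ℕ → ((ℕ → ℕ) → ℕ) → ℕ
  ∑ˢ zero    F = F (λ _ → 0)
  ∑ˢ (suc L) F = ∑< m (λ x → ∑ˢ L (λ s → F (x ◂ s)))

  ∑ˢ-mono : ∀ L {F G} → (∀ s → F s ≤ G s) → ∑ˢ L F ≤ ∑ˢ L G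
  ∑ˢ-mono zero    le = le _
  ∑ˢ-mono (suc L) le = ∑<-mono m _ _ (λ x _ → ∑ˢ-mono L (λ s → le (x ◂ s)))

  ∑ˢ-+ : ∀ L F G → ∑ˢ L (λ s → F s + G s) ≡ ∑ˢ L F + ∑ˢ L G
  ∑ˢ-+ zero    F G = refl
  ∑ˢ-+ (suc L) F G = trans (∑<-cong m (λ x → ∑ˢ-+ L (λ s → F (x ◂ s)) (λ s → G (x ◂ s)))) (∑<-+ m _ _)

  ∑ˢ-*ˡ : ∀ c L F → c * ∑ˢ L F ≡ ∑ˢ L (λ s → c * F s)
  ∑ˢ-*ˡ c zero    F = refl
  ∑ˢ-*ˡ c (suc L) F = trans (∑<-*ˡ c m _) (∑<-cong m (λ x → ∑ˢ-*ˡ c L (λ s → F (x ◂ s))))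

  ∑ˢ-const : ∀ L c → ∑ˢ L (λ _ → c) ≤ m ^ L * c
  ∑ˢ-const zero    c = ≤-reflexive (sym (+-identityʳ c))
  ∑ˢ-const (suc L) c = ≤-trans (∑<-const m _ (m ^ L * c) (λ _ _ → ∑ˢ-const L c)) (≤-reflexive (sym (*-assoc m (m ^ L) c)))

  private
    tail-bound : ∀ c L (G : ℕ → ℕ) → (∀ x → c * G x ≤ m ^ L) → c * ∑< m G ≤ m ^ suc L
    tail-bound c L G le = subst (_≤ m ^ suc L) (sym (∑<-*ˡ c m G)) (∑<-const m _ (m ^ L) (λ x _ → le x))

  -- Probability at most 1/m, multiplied out. It is an inequality because `a` may lie outside the
  -- range of the choices.
  one-coordinate : ∀ L i a → i < L → m * ∑ˢ L (λ s → [ s i ≟ a ]) ≤ m ^ L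
  one-coordinate (suc L) zero    a _ = *-monoʳ-≤ m (begin
    ∑< m (λ x → ∑ˢ L (λ _ → [ x ≟ a ]))   ≤⟨ ∑<-mono m _ _ (λ x _ → ∑ˢ-const L [ x ≟ a ]) ⟩
    ∑< m (λ x → m ^ L * [ x ≟ a ])        ≡⟨ sym (∑<-*ˡ (m ^ L) m _) ⟩
    m ^ L * ∑< m (λ x → [ x ≟ a ])        ≤⟨ *-monoʳ-≤ (m ^ L) (∑<-[≟] a m) ⟩
    m ^ L * 1                             ≡⟨ *-identityʳ _ ⟩
    m ^ L                                 ∎)
    where open ≤-Reasoning
  one-coordinate (suc L) (suc i) a (s≤s p) = tail-bound m L _ (λ x → one-coordinate L i a p)

  private
    head-coordinate : ∀ L j a b → j < L → m * m * ∑ˢ (suc L) (λ s → [ s 0 ≟ a ] * [ s (suc j) ≟ b ]) ≤ m ^ suc L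
    head-coordinate L j a b p = begin
      m * m * ∑< m (λ x → ∑ˢ L (λ s → [ x ≟ a ] * [ s j ≟ b ]))   ≡⟨ cong (m * m *_) (∑<-cong m (λ x → sym (∑ˢ-*ˡ [ x ≟ a ] L _))) ⟩
      m * m * ∑< m (λ x → [ x ≟ a ] * T)                          ≡⟨ cong (m * m *_) (∑<-*ʳ T m _) ⟩
      m * m * (∑< m (λ x → [ x ≟ a ]) * T)                        ≤⟨ *-monoʳ-≤ (m * m) (*-monoˡ-≤ T (∑<-[≟] a m)) ⟩
      m * m * (1 * T)                                             ≡⟨ e m T ⟩
      m * (m * T)                                                 ≤⟨ *-monoʳ-≤ m (one-coordinate L j b p) ⟩
      m * m ^ L                                                   ∎
      where
      open ≤-Reasoning
      T = ∑ˢ L (λ s → [ s j ≟ b ])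
      e : ∀ m t → m * m * (1 * t) ≡ m * (m * t)
      e = solve-∀

  -- Different coordinates are independent, whence the probability 1/m² of a prescribed pair of
  -- choices.
  two-coordinates : ∀ L i j a b → i < L → j < L → i ≢ j → m * m * ∑ˢ L (λ s → [ s i ≟ a ] * [ s j ≟ b ]) ≤ m ^ L
  two-coordinates (suc L) zero    zero    a b _ _ ne = ⊥-elim (ne refl)
  two-coordinates (suc L) zero    (suc j) a b _ (s≤s q) _ = head-coordinate L j a b q
  two-coordinates (suc L) (suc i) zero    a b (s≤s p) _ _ = ≤-trans
    (*-monoʳ-≤ (m * m) (∑ˢ-mono (suc L) (λ s → ≤-reflexive (*-comm [ s (suc i) ≟ a ] [ s 0 ≟ b ])))) (head-coordinate L i b a p)
  two-coordinates (suc L) (suc i) (suc j) a b (s≤s p) (s≤s q) ne =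
    tail-bound (m * m) L _ (λ x → two-coordinates L i j a b p q (λ e → ne (cong suc e)))

-- Expectation over the seeds

sumFin-mono : ∀ N {f g : Fin N → ℚ} → (∀ i → f i ℚ.≤ g i) → sumFin N f ℚ.≤ sumFin N g
sumFin-mono zero    le = ℚ.≤-refl
sumFin-mono (suc N) le = ℚ.+-mono-≤ (le Fin.zero) (sumFin-mono N (λ i → le (Fin.suc i)))

sumFin-cong : ∀ N {f g : Fin N → ℚ} → (∀ i → f i ≡ g i) → sumFin N f ≡ sumFin N g
sumFin-cong zero    eq = refl
sumFin-cong (suc N) eq = cong₂ ℚ._+_ (eq Fin.zero) (sumFin-cong N (λ i → eq (Fin.suc i)))

sumFin-+ : ∀ N (f g : Fin N → ℚ) → sumFin N (λ i → f i ℚ.+ g i) ≡ sumFin N f ℚ.+ sumFin N g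
sumFin-+ zero    f g = refl
sumFin-+ (suc N) f g = trans (cong (λ z → f Fin.zero ℚ.+ g Fin.zero ℚ.+ z) (sumFin-+ N (λ i → f (Fin.suc i)) (λ i → g (Fin.suc i))))
  (+-interchange (f Fin.zero) (g Fin.zero) _ _)
  where
  open Algebra.Properties.CommutativeSemigroup (CommutativeMonoid.commutativeSemigroup ℚ.+-0-commutativeMonoid) renaming (interchange to +-interchange)

sumFin-*ʳ : ∀ N (f : Fin N → ℚ) c → sumFin N (λ i → f i ℚ.* c) ≡ sumFin N f ℚ.* c
sumFin-*ʳ zero    f c = sym (ℚ.*-zeroˡ c)
sumFin-*ʳ (suc N) f c = trans (cong (λ z → f Fin.zero ℚ.* c ℚ.+ z) (sumFin-*ʳ N (λ i → f (Fin.suc i)) c))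
  (sym (ℚ.*-distribʳ-+ c (f Fin.zero) _))

module Expectation {n : ℕ} (A : RandAlg n) where

  𝔼 : (Fin (seeds A) → ℕ) → ℚ
  𝔼 f = sumFin (seeds A) (λ i → prob A i ℚ.* ⟦ f i ⟧)

  𝔼-+ : ∀ f g → 𝔼 (λ i → f i + g i) ≡ 𝔼 f ℚ.+ 𝔼 g
  𝔼-+ f g = trans (sumFin-cong (seeds A) (λ i → trans (cong (prob A i ℚ.*_) (⟦⟧-+ (f i) (g i)))
    (ℚ.*-distribˡ-+ (prob A i) ⟦ f i ⟧ ⟦ g i ⟧))) (sumFin-+ (seeds A) _ _)

  𝔼-const : ∀ c → 𝔼 (λ _ → c) ≡ ⟦ c ⟧
  𝔼-const c = trans (sumFin-*ʳ (seeds A) (prob A) ⟦ c ⟧) (trans (cong (ℚ._* ⟦ c ⟧) (prob-1 A)) (ℚ.*-identityˡ ⟦ c ⟧))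

  prob*-mono : ∀ i {x y} → x ≤ y → prob A i ℚ.* ⟦ x ⟧ ℚ.≤ prob A i ℚ.* ⟦ y ⟧
  prob*-mono i p = ℚ.*-monoˡ-≤-nonNeg (prob A i) {{ℚ.nonNegative (prob≥0 A i)}} (⟦⟧-mono p)

  𝔼-∑< : ∀ M K (G : ℕ → Fin (seeds A) → ℕ) → (∀ x → x < M → ⟦ K ⟧ ℚ.≤ 𝔼 (G x)) →
    ⟦ M * K ⟧ ℚ.≤ 𝔼 (λ i → ∑< M (λ x → G x i))
  𝔼-∑< zero    K G le = ℚ.≤-reflexive (sym (𝔼-const 0))
  𝔼-∑< (suc M) K G le = begin
    ⟦ K + M * K ⟧                                  ≡⟨ cong ⟦_⟧ (+-comm K (M * K)) ⟩
    ⟦ M * K + K ⟧                                  ≡⟨ ⟦⟧-+ (M * K) K ⟩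
    ⟦ M * K ⟧ ℚ.+ ⟦ K ⟧                            ≤⟨ ℚ.+-mono-≤ (𝔼-∑< M K G (λ x p → le x (m≤n⇒m≤1+n p))) (le M ≤-refl) ⟩
    𝔼 (λ i → ∑< M (λ x → G x i)) ℚ.+ 𝔼 (G M)       ≡⟨ sym (𝔼-+ (λ i → ∑< M (λ x → G x i)) (G M)) ⟩
    𝔼 (λ i → ∑< (suc M) (λ x → G x i))             ∎
    where open ℚ.≤-Reasoning

  module _ (m : ℕ) where
    open Sequences m

    -- Sequences continue with 0 beyond `L`, so `0 < m` is what keeps them bounded there.
    𝔼-∑ˢ : ∀ L (G : (ℕ → ℕ) → Fin (seeds A) → ℕ) → 0 < m → (∀ s → (∀ i → s i < m) → ⟦ 1 ⟧ ℚ.≤ 𝔼 (G s)) →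
      ⟦ m ^ L ⟧ ℚ.≤ 𝔼 (λ i → ∑ˢ L (λ s → G s i))
    𝔼-∑ˢ zero    G 0<m le = le (λ _ → 0) (λ _ → 0<m)
    𝔼-∑ˢ (suc L) G 0<m le = 𝔼-∑< m (m ^ L) (λ x i → ∑ˢ L (λ s → G (x ◂ s) i))
      (λ x x<m → 𝔼-∑ˢ L (λ s → G (x ◂ s)) 0<m (λ s s<m → le (x ◂ s) (λ { zero → x<m ; (suc i) → s<m i })))

  -- Otherwise `f` is at most one less than the bound on every seed of positive probability, and
  -- seeds of probability 0 contribute nothing, so the mean would be too small.
  attained : ∀ K (f : Fin (seeds A) → ℕ) → 0 < K → ⟦ K ⟧ ℚ.≤ 𝔼 f → ∃ λ i → 0ℚ ℚ.< prob A i × K ≤ f i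
  attained (suc K) f _ le with Fin.any? (λ i → (0ℚ ℚ.<? prob A i) ×-dec (suc K ≤? f i))
  ... | yes p = p
  ... | no ¬p = ⊥-elim (<⇒≱ (n<1+n K) (⟦⟧-cancel (ℚ.≤-trans le (ℚ.≤-trans
      (sumFin-mono (seeds A) small) (ℚ.≤-reflexive (𝔼-const K))))))
    where
    small : ∀ i → prob A i ℚ.* ⟦ f i ⟧ ℚ.≤ prob A i ℚ.* ⟦ K ⟧
    small i with 0ℚ ℚ.<? prob A i
    ... | yes q = prob*-mono i (≮⇒≥ (λ r → ¬p (i , q , r)))
    ... | no ¬q = ℚ.≤-reflexive (trans (cong (ℚ._* ⟦ f i ⟧) p≡0) (trans (ℚ.*-zeroˡ ⟦ f i ⟧)
        (sym (trans (cong (ℚ._* ⟦ K ⟧) p≡0) (ℚ.*-zeroˡ ⟦ K ⟧)))))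
      where
      p≡0 : prob A i ≡ 0ℚ
      p≡0 = ℚ.≤-antisym (ℚ.≮⇒≥ ¬q) (prob≥0 A i)

module Weights {n : ℕ} (k : ℕ) (α p : ℚ) (A : RandAlg n) (M : Metric n) where

  -- The function summed in `SucceedsWithProb` is built with a conditional local to that definition.
  -- Unification supplies it here, and all that is used of it later are the two cases in
  -- `weights-≡`.
  weights : SucceedsWithProb k α p A M → ∃ λ f → p ℚ.≤ sumFin (seeds A) f
  weights (good , _ , le) = _ , le

  weights-≡ : (S : SucceedsWithProb k α p A M) → ∀ i →
    (proj₁ (weights S) i ≡ prob A i × Estimates k M α (run (alg A i) M)) ⊎ proj₁ (weights S) i ≡ 0ℚ
  weights-≡ (good , est , _) i with good i in e
  ... | true  = inj₁ (refl , est i e)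
  ... | false = inj₂ refl

-- Here `x` is the number of hits of a seed. Without a hit the seed cannot succeed on both
-- instances, so it counts once; with a hit, 1 + x ≥ 2 covers both successes.
weight-sum : ∀ {p a b : ℚ} {G G′ : Set} x → 0ℚ ℚ.≤ p → (a ≡ p × G) ⊎ a ≡ 0ℚ → (b ≡ p × G′) ⊎ b ≡ 0ℚ →
  (x ≡ 0 → G → G′ → ⊥) → a ℚ.+ b ℚ.≤ p ℚ.* ⟦ 1 + x ⟧
weight-sum {p} x 0≤p c c′ excl = go x c c′ excl
  where
  mono : ∀ {y z} → y ≤ z → p ℚ.* ⟦ y ⟧ ℚ.≤ p ℚ.* ⟦ z ⟧
  mono q = ℚ.*-monoˡ-≤-nonNeg p {{ℚ.nonNegative 0≤p}} (⟦⟧-mono q)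
  p*1 : p ≡ p ℚ.* ⟦ 1 ⟧
  p*1 = sym (trans (cong (p ℚ.*_) ⟦1⟧≡1ℚ) (ℚ.*-identityʳ p))
  p≤ : ∀ x → p ℚ.≤ p ℚ.* ⟦ 1 + x ⟧
  p≤ x = ℚ.≤-trans (ℚ.≤-reflexive p*1) (mono (s≤s z≤n))
  go : ∀ {a b : ℚ} {G G′ : Set} x → (a ≡ p × G) ⊎ a ≡ 0ℚ → (b ≡ p × G′) ⊎ b ≡ 0ℚ →
    (x ≡ 0 → G → G′ → ⊥) → a ℚ.+ b ℚ.≤ p ℚ.* ⟦ 1 + x ⟧
  go x       (inj₂ refl)       (inj₂ refl)       _    = ℚ.≤-trans 0≤p (p≤ x)
  go x       (inj₂ refl)       (inj₁ (refl , _)) _    = ℚ.≤-trans (ℚ.≤-reflexive (ℚ.+-identityˡ p)) (p≤ x)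
  go x       (inj₁ (refl , _)) (inj₂ refl)       _    = ℚ.≤-trans (ℚ.≤-reflexive (ℚ.+-identityʳ p)) (p≤ x)
  go zero    (inj₁ (_ , g))    (inj₁ (_ , g′))   excl = ⊥-elim (excl refl g g′)
  go (suc x) (inj₁ (refl , _)) (inj₁ (refl , _)) _    = begin
    p ℚ.+ p                                 ≤⟨ ℚ.+-mono-≤ (ℚ.≤-reflexive p*1) (p≤ x) ⟩
    p ℚ.* ⟦ 1 ⟧ ℚ.+ p ℚ.* ⟦ 1 + x ⟧         ≡⟨ sym (ℚ.*-distribˡ-+ p ⟦ 1 ⟧ ⟦ 1 + x ⟧) ⟩
    p ℚ.* (⟦ 1 ⟧ ℚ.+ ⟦ 1 + x ⟧)             ≡⟨ cong (p ℚ.*_) (sym (⟦⟧-+ 1 (1 + x))) ⟩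
    p ℚ.* ⟦ 1 + suc x ⟧                     ∎
    where open ℚ.≤-Reasoning

-- Query trees, and the adversary argument

queries : ∀ {n} → QTree n → Metric n → List (Edge n)
queries (output x)    M = []
queries (query u v f) M = (u , v) ∷ queries (f (w M u v)) M

length-queries : ∀ {n} (t : QTree n) M → length (queries t M) ≡ numQueries t M
length-queries (output x)    M = refl
length-queries (query u v f) M = cong suc (length-queries (f (w M u v)) M)

-- Equal answers keep both runs on the same branch, so even for adaptive queries it is enough to
-- inspect those made on `M`.
run-agree : ∀ {n} (t : QTree n) M M′ → All (λ e → w M (proj₁ e) (proj₂ e) ≡ w M′ (proj₁ e) (proj₂ e)) (queries t M) →
  run t M ≡ run t M′
run-agree (output x)    M M′ _        = refl
run-agree (query u v f) M M′ (e ∷ es) = trans (run-agree (f (w M u v)) M M′ es) (cong (λ x → run (f x) M′) e)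


module Adversary (h n m : ℕ) (fits : suc m * 2 ^ suc (suc h) ≤ n) (0<m : 0 < m) where
  open Heights h using (H; N)
  open Heap h using (k)
  open Planted h n m fits
  open Sequences m

  private instance
    k≢0 : NonZero k
    k≢0 = m^n≢0 2 N

  -- A query of a point with itself answers 0 in every metric. Counting it would also break the 1/m²
  -- bound, since a single point can be planted with probability 1/m.
  hit : (ℕ → ℕ) → Edge n → ℕ
  hit s (u , v) with u Fin.≟ v
  ... | yes _ = 0
  ... | no  _ = if planted s u ∧ planted s v then 1 else 0

  hits : (ℕ → ℕ) → List (Edge n) → ℕ
  hits s es = sum (map (hit s) es)

  hit-≢ : ∀ s {u v} → u ≢ v → hit s (u , v) ≡ (if planted s u ∧ planted s v then 1 else 0)
  hit-≢ s {u} {v} ne with u Fin.≟ v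
  ... | yes e = ⊥-elim (ne e)
  ... | no  _ = refl

  miss : ∀ s e → hit s e ≡ 0 → w M₀ (proj₁ e) (proj₂ e) ≡ w (M s) (proj₁ e) (proj₂ e)
  miss s (u , v) eq = cong ⟦_⟧ (same (u Fin.≟ v) (dichotomy (planted s u ∧ planted s v)))
    where
    same : Dec (u ≡ v) → planted s u ∧ planted s v ≡ true ⊎ planted s u ∧ planted s v ≡ false →
      dist nowhere u v ≡ dist (planted s) u v
    same _          (inj₂ e) = sym (dist-agree (planted s) u v e)
    same (yes refl) (inj₁ _) = trans (dist-refl nowhere u) (sym (dist-refl (planted s) u))
    same (no ne)    (inj₁ e) with trans (sym (cong (λ b → if b then 1 else 0) e)) (trans (sym (hit-≢ s ne)) eq)
    ... | ()

  misses : ∀ s es → hits s es ≡ 0 → All (λ e → w M₀ (proj₁ e) (proj₂ e) ≡ w (M s) (proj₁ e) (proj₂ e)) es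
  misses s []       _  = []
  misses s (e ∷ es) eq = miss s e (m+n≡0⇒m≡0 (hit s e) eq) ∷ misses s es (m+n≡0⇒n≡0 (hit s e) eq)

  -- The choice of its group under which `v` is the planted point.
  offset : Fin n → ℕ
  offset v = Fin.toℕ v ND./ k ∸ 1

  planted-hidden : ∀ s v → planted s v ≡ true → k ≤ Fin.toℕ v
  planted-hidden s v e = subst (k ≤_) (sym (planted-true s v e)) (≤-trans (m≤m+n k _) (m≤n+m _ (ident v)))

  planted-offset : ∀ s v → planted s v ≡ true → s (ident v) ≡ offset v
  planted-offset s v e = sym (cong (_∸ 1) (begin
    Fin.toℕ v ND./ k                                     ≡⟨ cong (λ z → z ND./ k) (planted-true s v e) ⟩
    (ident v + suc (s (ident v)) * k) ND./ k             ≡⟨ ND.+-distrib-/-∣ʳ (ident v) (divides (suc (s (ident v))) refl) ⟩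
    ident v ND./ k + (suc (s (ident v)) * k) ND./ k      ≡⟨ cong₂ _+_ (ND.m<n⇒m/n≡0 (ident-hidden< v (planted-hidden s v e))) (ND.m*n/n≡m (suc (s (ident v))) k) ⟩
    suc (s (ident v))                                    ∎))
    where open ≡-Reasoning

  hit≤ : ∀ s u v → hit s (u , v) ≤ [ s (ident u) ≟ offset u ] * [ s (ident v) ≟ offset v ]
  hit≤ s u v with u Fin.≟ v
  ... | yes _ = z≤n
  ... | no  _ with planted s u in pu | planted s v in pv
  ...   | true  | true  = ≤-reflexive (sym (cong₂ _*_ ([≟]-yes (planted-offset s u pu)) ([≟]-yes (planted-offset s v pv))))
  ...   | true  | false = z≤n
  ...   | false | _     = z≤n

  hit≡0 : ∀ s u v → (planted s u ≡ true → planted s v ≡ true → u ≡ v) → hit s (u , v) ≡ 0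
  hit≡0 s u v same with u Fin.≟ v
  ... | yes _ = refl
  ... | no ne with planted s u | planted s v
  ...   | true  | true  = ⊥-elim (ne (same refl refl))
  ...   | true  | false = refl
  ...   | false | _     = refl

  private
    never-hit : ∀ u v → (∀ s → hit s (u , v) ≡ 0) → m * m * ∑ˢ k (λ s → hit s (u , v)) ≤ m ^ k
    never-hit u v z = subst (_≤ m ^ k) (sym (trans (cong (m * m *_) (n≤0⇒n≡0 (≤-trans
        (∑ˢ-mono k (λ s → ≤-reflexive (z s))) (≤-trans (∑ˢ-const k 0) (≤-reflexive (*-zeroʳ (m ^ k))))))) (*-zeroʳ (m * m)))) z≤n

  -- Terminals are never planted, and two points of one group never both. In the remaining case a
  -- hit prescribes the choices of two different groups.
  hit-probability : ∀ e → m * m * ∑ˢ k (λ s → hit s e) ≤ m ^ k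
  hit-probability (u , v) with <-≤-connex (Fin.toℕ u) k | <-≤-connex (Fin.toℕ v) k | ident u ≟ ident v
  ... | inj₁ p | _      | _     = never-hit u v (λ s → hit≡0 s u v (λ e _ → ⊥-elim (<⇒≱ p (planted-hidden s u e))))
  ... | inj₂ _ | inj₁ p | _     = never-hit u v (λ s → hit≡0 s u v (λ _ e → ⊥-elim (<⇒≱ p (planted-hidden s v e))))
  ... | inj₂ _ | inj₂ _ | yes e = never-hit u v (λ s → hit≡0 s u v (λ p q → Fin.toℕ-injective
      (trans (planted-true s u p) (trans (cong (λ z → z + suc (s z) * k) e) (sym (planted-true s v q))))))
  ... | inj₂ p | inj₂ q | no ne = ≤-trans (*-monoʳ-≤ (m * m) (∑ˢ-mono k (λ s → hit≤ s u v)))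
      (two-coordinates k (ident u) (ident v) (offset u) (offset v) (ident-hidden< u p) (ident-hidden< v q) ne)

  hits-probability : ∀ es → m * m * ∑ˢ k (λ s → hits s es) ≤ length es * m ^ k
  hits-probability [] = ≤-trans (*-monoʳ-≤ (m * m) (∑ˢ-const k 0))
    (≤-reflexive (trans (cong (m * m *_) (*-zeroʳ (m ^ k))) (*-zeroʳ (m * m))))
  hits-probability (e ∷ es) = ≤-trans (≤-reflexive (trans (cong (m * m *_) (∑ˢ-+ k (λ s → hit s e) (λ s → hits s es)))
      (*-distribˡ-+ (m * m) (∑ˢ k (λ s → hit s e)) _)))
    (+-mono-≤ (hit-probability e) (hits-probability es))

  module _ (A : RandAlg n) (α : ℚ) (0≤α : 0ℚ ℚ.≤ α) (gap : α ℚ.* ⟦ 3 * N * 2 ^ H ⟧ ℚ.< ⟦ (5 * H + 2) * 2 ^ H ⟧)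
    (est : EstimatesWHP k α A) where
    open Expectation A

    seed-hits : (ℕ → ℕ) → Fin (seeds A) → ℕ
    seed-hits s i = hits s (queries (alg A i) M₀)

    -- A common estimate would be at least the lower bound for the unplanted metric and at most `α`
    -- times the cost of the hidden tree, against `gap`.
    indistinguishable : ∀ s → (∀ i → s i < m) → ∀ X → Estimates k M₀ α X → Estimates k (M s) α X → ⊥
    indistinguishable s s<m X (c₀ , ((S₀ , cost≡) , _) , c₀≤X , _) (c , (_ , minimal) , _ , X≤αc) =
      ℚ.<-irrefl refl (begin-strict
        ⟦ (5 * H + 2) * 2 ^ H ⟧     ≤⟨ unplanted-bound S₀ ⟩
        cost M₀ S₀                  ≡⟨ cost≡ ⟩
        c₀                          ≤⟨ c₀≤X ⟩
        X                           ≤⟨ X≤αc ⟩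
        α ℚ.* c                     ≤⟨ ℚ.*-monoˡ-≤-nonNeg α {{ℚ.nonNegative 0≤α}} (ℚ.≤-trans (minimal (Tree.tree s s<m)) (Tree.tree-cost s s<m)) ⟩
        α ℚ.* ⟦ 3 * N * 2 ^ H ⟧     <⟨ gap ⟩
        ⟦ (5 * H + 2) * 2 ^ H ⟧     ∎)
      where open ℚ.≤-Reasoning

    -- A seed that succeeds on both M₀ and M s must query a pair on which they differ.
    expected-hits : ∀ s → (∀ i → s i < m) → ⟦ 1 ⟧ ℚ.≤ 𝔼 (λ i → seed-hits s i + (seed-hits s i + seed-hits s i))
    expected-hits s s<m = subst₂ ℚ._≤_ (sym ⟦1⟧≡1ℚ) (sym (trans (𝔼-+ F _) (cong (λ z → 𝔼 F ℚ.+ z) (𝔼-+ F F))))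
      (ℚ.+-mono-≤ third (ℚ.+-mono-≤ third third))
      where
      F : Fin (seeds A) → ℕ
      F = seed-hits s
      module W₀ = Weights k α (+ 2 / 3) A M₀
      module Wₛ = Weights k α (+ 2 / 3) A (M s)
      f₀ fₛ : Fin (seeds A) → ℚ
      f₀ = proj₁ (W₀.weights (est M₀))
      fₛ = proj₁ (Wₛ.weights (est (M s)))
      pointwise : ∀ i → f₀ i ℚ.+ fₛ i ℚ.≤ prob A i ℚ.* ⟦ 1 + F i ⟧
      pointwise i = weight-sum (F i) (prob≥0 A i) (W₀.weights-≡ (est M₀) i) (Wₛ.weights-≡ (est (M s)) i)
        (λ F≡0 g₀ gₛ → indistinguishable s s<m _ g₀ (subst (Estimates k (M s) α)
          (sym (run-agree (alg A i) M₀ (M s) (misses s (queries (alg A i) M₀) F≡0))) gₛ))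
      four-thirds : + 2 / 3 ℚ.+ + 2 / 3 ℚ.≤ ℚ.1ℚ ℚ.+ 𝔼 F
      four-thirds = begin
        + 2 / 3 ℚ.+ + 2 / 3                              ≤⟨ ℚ.+-mono-≤ (proj₂ (W₀.weights (est M₀))) (proj₂ (Wₛ.weights (est (M s)))) ⟩
        sumFin (seeds A) f₀ ℚ.+ sumFin (seeds A) fₛ      ≡⟨ sym (sumFin-+ (seeds A) f₀ fₛ) ⟩
        sumFin (seeds A) (λ i → f₀ i ℚ.+ fₛ i)           ≤⟨ sumFin-mono (seeds A) pointwise ⟩
        𝔼 (λ i → 1 + F i)                                ≡⟨ 𝔼-+ (λ _ → 1) F ⟩
        𝔼 (λ _ → 1) ℚ.+ 𝔼 F                              ≡⟨ cong (ℚ._+ 𝔼 F) (trans (𝔼-const 1) ⟦1⟧≡1ℚ) ⟩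
        ℚ.1ℚ ℚ.+ 𝔼 F                                     ∎
        where open ℚ.≤-Reasoning
      third : + 1 / 3 ℚ.≤ 𝔼 F
      third = begin
        ℚ.- ℚ.1ℚ ℚ.+ (+ 2 / 3 ℚ.+ + 2 / 3)   ≤⟨ ℚ.+-monoʳ-≤ (ℚ.- ℚ.1ℚ) four-thirds ⟩
        ℚ.- ℚ.1ℚ ℚ.+ (ℚ.1ℚ ℚ.+ 𝔼 F)         ≡⟨ sym (ℚ.+-assoc (ℚ.- ℚ.1ℚ) ℚ.1ℚ (𝔼 F)) ⟩
        ℚ.- ℚ.1ℚ ℚ.+ ℚ.1ℚ ℚ.+ 𝔼 F           ≡⟨ ℚ.+-identityˡ (𝔼 F) ⟩
        𝔼 F                                   ∎
        where open ℚ.≤-Reasoning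

    -- The expected number of hits is tripled so that its bound 1/3 becomes the integer 1. Summed
    -- over all m^k choices, some seed of positive probability has at least m^k/3 hits on its run on
    -- `M₀`, while one query accounts for at most m^k/m² of them.
    many-queries : ∃ λ i → 0ℚ ℚ.< prob A i × m * m ≤ 3 * numQueries (alg A i) M₀
    many-queries = i , proj₁ (proj₂ found) , *-cancelʳ-≤ (m * m) (3 * numQueries (alg A i) M₀) (m ^ k) {{m^n≢0 m k {{>-nonZero 0<m}}}} (begin
      m * m * m ^ k                                           ≤⟨ *-monoʳ-≤ (m * m) (proj₂ (proj₂ found)) ⟩
      m * m * ∑ˢ k (λ s → F s + (F s + F s))                  ≡⟨ cong (m * m *_) (trans (∑ˢ-+ k F _) (cong (λ z → ∑ˢ k F + z) (∑ˢ-+ k F F))) ⟩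
      m * m * (∑ˢ k F + (∑ˢ k F + ∑ˢ k F))                    ≡⟨ e (m * m) (∑ˢ k F) ⟩
      3 * (m * m * ∑ˢ k F)                                    ≤⟨ *-monoʳ-≤ 3 (hits-probability qs) ⟩
      3 * (length qs * m ^ k)                                 ≡⟨ cong (λ a → 3 * (a * m ^ k)) (length-queries (alg A i) M₀) ⟩
      3 * (numQueries (alg A i) M₀ * m ^ k)                   ≡⟨ sym (*-assoc 3 (numQueries (alg A i) M₀) (m ^ k)) ⟩
      3 * numQueries (alg A i) M₀ * m ^ k                     ∎)
      where
      open ≤-Reasoning
      found : ∃ λ i → 0ℚ ℚ.< prob A i × m ^ k ≤ ∑ˢ k (λ s → seed-hits s i + (seed-hits s i + seed-hits s i))
      found = attained (m ^ k) _ (m^n>0 m {{>-nonZero 0<m}} k)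
        (𝔼-∑ˢ m k (λ s i → seed-hits s i + (seed-hits s i + seed-hits s i)) 0<m expected-hits)
      i : Fin (seeds A)
      i = proj₁ found
      qs : List (Edge n)
      qs = queries (alg A i) M₀
      F : (ℕ → ℕ) → ℕ
      F s = hits s qs
      e : ∀ a b → a * (b + (b + b)) ≡ 3 * (a * b)
      e = solve-∀

-- The approximation factor and the choice of parameters

opaque
  unfolding ⟦_⟧

  /-*-cancel : ∀ a b → (+ a / suc b) ℚ.* ⟦ suc b ⟧ ≡ ⟦ a ⟧
  /-*-cancel a b = ℚ.toℚᵘ-injective (ℚᵘ.≃-trans (ℚ.toℚᵘ-homo-* (+ a / suc b) ⟦ suc b ⟧)
    (ℚᵘ.≃-trans (ℚᵘ.*-cong (ℚ.toℚᵘ-fromℚᵘ (ℚᵘ.mkℚᵘ (+ a) b)) (toℚᵘ-⟦⟧ (suc b)))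
      (ℚᵘ.≃-trans (ℚᵘ.*≡* e) (ℚᵘ.≃-sym (toℚᵘ-⟦⟧ a)))))
    where
    e : + a ℤ.* + suc b ℤ.* + 1 ≡ + a ℤ.* + (suc b * 1)
    e = trans (ℤ.*-identityʳ (+ a ℤ.* + suc b)) (cong (λ z → + a ℤ.* + z) (sym (*-identityʳ (suc b))))

^-distribʳ-* : ∀ x y a → (x * y) ^ a ≡ x ^ a * y ^ a
^-distribʳ-* x y zero    = refl
^-distribʳ-* x y (suc a) = trans (cong (x * y *_) (^-distribʳ-* x y a)) (e x y (x ^ a) (y ^ a))
  where
  e : ∀ x y p q → x * y * (p * q) ≡ x * p * (y * q)
  e = solve-∀

m<[1+m/n]*n : ∀ m n .{{_ : NonZero n}} → m < suc (m ND./ n) * n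
m<[1+m/n]*n m n = subst (_< suc (m ND./ n) * n) (sym (ND.m≡m%n+[m/n]*n m n)) (+-monoˡ-< (m ND./ n * n) (ND.m%n<n m n))

module Factor (a b : ℕ) (3a≤ : 3 * a ≤ 2 * suc b) where

  α : ℚ
  α = (+ 5 / 3) - (+ a / suc b)

  private
    -- The numerator of `α` over the denominator 3(b + 1); the truncated subtraction is exact since
    -- ε ≤ 2/3.
    X : ℕ
    X = 5 * suc b ∸ 3 * a

    X+3a : X + 3 * a ≡ 5 * suc b
    X+3a = m∸n+n≡m (≤-trans 3a≤ (*-monoˡ-≤ (suc b) {2} {5} (s≤s (s≤s z≤n))))

    α-numerator : α ℚ.* ⟦ 3 * suc b ⟧ ≡ ⟦ X ⟧
    α-numerator = begin
      α ℚ.* ⟦ 3 * suc b ⟧                                              ≡⟨ ℚ.*-distribʳ-+ ⟦ 3 * suc b ⟧ (+ 5 / 3) (ℚ.- (+ a / suc b)) ⟩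
      (+ 5 / 3) ℚ.* ⟦ 3 * suc b ⟧ ℚ.+ ℚ.- (+ a / suc b) ℚ.* ⟦ 3 * suc b ⟧ ≡⟨ cong₂ ℚ._+_ first second ⟩
      ⟦ 5 * suc b ⟧ ℚ.+ ℚ.- ⟦ 3 * a ⟧                                  ≡⟨ cong (λ z → ⟦ z ⟧ ℚ.+ ℚ.- ⟦ 3 * a ⟧) (sym X+3a) ⟩
      ⟦ X + 3 * a ⟧ ℚ.+ ℚ.- ⟦ 3 * a ⟧                                  ≡⟨ cong (λ z → z ℚ.+ ℚ.- ⟦ 3 * a ⟧) (⟦⟧-+ X (3 * a)) ⟩
      ⟦ X ⟧ ℚ.+ ⟦ 3 * a ⟧ ℚ.+ ℚ.- ⟦ 3 * a ⟧                            ≡⟨ ℚ.+-assoc ⟦ X ⟧ ⟦ 3 * a ⟧ (ℚ.- ⟦ 3 * a ⟧) ⟩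
      ⟦ X ⟧ ℚ.+ (⟦ 3 * a ⟧ ℚ.+ ℚ.- ⟦ 3 * a ⟧)                          ≡⟨ cong (λ z → ⟦ X ⟧ ℚ.+ z) (ℚ.+-inverseʳ ⟦ 3 * a ⟧) ⟩
      ⟦ X ⟧ ℚ.+ 0ℚ                                                     ≡⟨ ℚ.+-identityʳ ⟦ X ⟧ ⟩
      ⟦ X ⟧                                                            ∎
      where
      open ≡-Reasoning
      first : (+ 5 / 3) ℚ.* ⟦ 3 * suc b ⟧ ≡ ⟦ 5 * suc b ⟧
      first = trans (cong ((+ 5 / 3) ℚ.*_) (⟦⟧-* 3 (suc b))) (trans (sym (ℚ.*-assoc (+ 5 / 3) ⟦ 3 ⟧ ⟦ suc b ⟧))
        (trans (cong (ℚ._* ⟦ suc b ⟧) (/-*-cancel 5 2)) (sym (⟦⟧-* 5 (suc b)))))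
      second : ℚ.- (+ a / suc b) ℚ.* ⟦ 3 * suc b ⟧ ≡ ℚ.- ⟦ 3 * a ⟧
      second = trans (sym (ℚ.neg-distribˡ-* (+ a / suc b) ⟦ 3 * suc b ⟧)) (cong ℚ.-_
        (trans (cong (λ z → (+ a / suc b) ℚ.* ⟦ z ⟧) (*-comm 3 (suc b))) (trans (cong ((+ a / suc b) ℚ.*_) (⟦⟧-* (suc b) 3))
          (trans (sym (ℚ.*-assoc (+ a / suc b) ⟦ suc b ⟧ ⟦ 3 ⟧)) (trans (cong (ℚ._* ⟦ 3 ⟧) (/-*-cancel a b))
            (trans (sym (⟦⟧-* a 3)) (cong ⟦_⟧ (*-comm a 3))))))))

  0≤⟦⟧ : ∀ c → 0ℚ ℚ.≤ ⟦ c ⟧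
  0≤⟦⟧ c = subst (ℚ._≤ ⟦ c ⟧) ⟦0⟧≡0ℚ (⟦⟧-mono z≤n)

  0≤α : 0ℚ ℚ.≤ α
  0≤α = ℚ.*-cancelʳ-≤-pos ⟦ 3 * suc b ⟧ {{ℚ.positive (subst (ℚ._< ⟦ 3 * suc b ⟧) ⟦0⟧≡0ℚ (⟦⟧-mono-< (s≤s z≤n)))}}
    (subst₂ ℚ._≤_ (sym (ℚ.*-zeroˡ ⟦ 3 * suc b ⟧)) (sym α-numerator) (0≤⟦⟧ X))

  -- The ratio of the two costs is 5/3 − 1/(H + 1), and H + 1 > 1/ε.
  gap : ∀ H P → 0 < P → suc b < suc H * a → α ℚ.* ⟦ 3 * suc H * P ⟧ ℚ.< ⟦ (5 * H + 2) * P ⟧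
  gap H P 0<P lt = ℚ.*-cancelʳ-<-nonNeg ⟦ suc b ⟧ {{ℚ.nonNegative (0≤⟦⟧ (suc b))}}
    (subst₂ ℚ._<_ (sym lhs) (⟦⟧-* ((5 * H + 2) * P) (suc b)) (⟦⟧-mono-< nat))
    where
    lhs : α ℚ.* ⟦ 3 * suc H * P ⟧ ℚ.* ⟦ suc b ⟧ ≡ ⟦ X * (suc H * P) ⟧
    lhs = trans (ℚ.*-assoc α ⟦ 3 * suc H * P ⟧ ⟦ suc b ⟧) (trans (cong (α ℚ.*_) (trans (sym (⟦⟧-* (3 * suc H * P) (suc b)))
        (trans (cong ⟦_⟧ (e H P b)) (⟦⟧-* (3 * suc b) (suc H * P)))))
      (trans (sym (ℚ.*-assoc α ⟦ 3 * suc b ⟧ ⟦ suc H * P ⟧)) (trans (cong (ℚ._* ⟦ suc H * P ⟧) α-numerator) (sym (⟦⟧-* X (suc H * P))))))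
      where
      e : ∀ H P b → 3 * suc H * P * suc b ≡ 3 * suc b * (suc H * P)
      e = solve-∀
    core : X * suc H < (5 * H + 2) * suc b
    core = +-cancelʳ-< (3 * suc b) (X * suc H) ((5 * H + 2) * suc b) (begin-strict
      X * suc H + 3 * suc b             <⟨ +-monoʳ-< (X * suc H) (*-monoʳ-< 3 lt) ⟩
      X * suc H + 3 * (suc H * a)       ≡⟨ e₁ X H a ⟩
      (X + 3 * a) * suc H               ≡⟨ cong (_* suc H) X+3a ⟩
      5 * suc b * suc H                 ≡⟨ e₂ H b ⟩
      (5 * H + 2) * suc b + 3 * suc b   ∎)
      where
      open ≤-Reasoning
      e₁ : ∀ X H a → X * suc H + 3 * (suc H * a) ≡ (X + 3 * a) * suc H
      e₁ = solve-∀
      e₂ : ∀ H b → 5 * suc b * suc H ≡ (5 * H + 2) * suc b + 3 * suc b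
      e₂ = solve-∀
    nat : X * (suc H * P) < (5 * H + 2) * P * suc b
    nat = subst₂ _<_ (*-assoc X (suc H) P) (e₃ (5 * H + 2) (suc b) P) (*-monoˡ-< P {{>-nonZero 0<P}} core)
      where
      e₃ : ∀ x y z → x * y * z ≡ x * z * y
      e₃ = solve-∀

module Parameters (a b : ℕ) (0<a : 0 < a) (3a<2b : 3 * a < 2 * suc b) where

  private instance
    a≢0 : NonZero a
    a≢0 = >-nonZero 0<a

  -- Since ε < 1 the quotient ⌊1/ε⌋ is at least 1, so subtracting 1 truncates nothing.
  h : ℕ
  h = suc b ND./ a ∸ 1

  a≤b : a ≤ suc b
  a≤b = *-cancelˡ-≤ 2 (≤-trans (*-monoˡ-≤ a {2} {3} (s≤s (s≤s z≤n))) (<⇒≤ 3a<2b))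

  H≡ : suc h ≡ suc b ND./ a
  H≡ = m+[n∸m]≡n (ND.m≥n⇒m/n>0 a≤b)

  H*a≤ : suc h * a ≤ suc b
  H*a≤ = subst (λ z → z * a ≤ suc b) (sym H≡) (ND.m/n*n≤m (suc b) a)

  <N*a : suc b < suc (suc h) * a
  <N*a = subst (λ z → suc b < suc z * a) (sym H≡) (m<[1+m/n]*n (suc b) a)

  k : ℕ
  k = 2 ^ suc (suc h)

  private instance
    k≢0 : NonZero k
    k≢0 = m^n≢0 2 (suc (suc h))

  module _ (n : ℕ) (2k≤n : 2 * k ≤ n) where

    -- One of the ⌊n/k⌋ blocks is taken by the terminals. For n ≥ 2k at least one block of
    -- candidates remains.
    m : ℕ
    m = n ND./ k ∸ 1

    2≤n/k : 2 ≤ n ND./ k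
    2≤n/k = subst (_≤ n ND./ k) (ND.m*n/n≡m 2 k) (ND./-monoˡ-≤ k 2k≤n)

    m≡ : suc m ≡ n ND./ k
    m≡ = m+[n∸m]≡n (<⇒≤ 2≤n/k)

    0<m : 0 < m
    0<m = ≤-pred (subst (2 ≤_) (sym m≡) 2≤n/k)

    fits : suc m * k ≤ n
    fits = subst (λ z → z * k ≤ n) (sym m≡) (ND.m/n*n≤m n k)

    n≤3mk : n ≤ 3 * m * k
    n≤3mk = ≤-trans (<⇒≤ (subst (λ z → n < suc z * k) (sym m≡) (m<[1+m/n]*n n k))) (*-monoˡ-≤ k 2+m≤3m)
      where
      2+m≤3m : suc (suc m) ≤ 3 * m
      2+m≤3m = subst (2 + m ≤_) (e m) (+-monoˡ-≤ m (*-monoʳ-≤ 2 0<m))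
        where
        e : ∀ m → 2 * m + m ≡ 3 * m
        e = solve-∀

    -- The constant is 108 = 3·(3·2)²: n ≤ 3mk with k = 2·2^H, and m² ≤ 3q. Raising to the power `a`
    -- turns 4^H into 4^(Ha), at most 4^(b+1), so that 4^(1/ε) is expressed without roots.
    query-bound : ∀ q → m * m ≤ 3 * q → n ^ (2 * a) ≤ (108 * q) ^ a * 4 ^ suc b
    query-bound q le = begin
      n ^ (2 * a)                           ≡⟨ sym (^-*-assoc n 2 a) ⟩
      (n ^ 2) ^ a                           ≤⟨ ^-monoˡ-≤ a squares ⟩
      (108 * q * 4 ^ suc h) ^ a             ≡⟨ ^-distribʳ-* (108 * q) (4 ^ suc h) a ⟩
      (108 * q) ^ a * (4 ^ suc h) ^ a       ≡⟨ cong ((108 * q) ^ a *_) (^-*-assoc 4 (suc h) a) ⟩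
      (108 * q) ^ a * 4 ^ (suc h * a)       ≤⟨ *-monoʳ-≤ ((108 * q) ^ a) (^-monoʳ-≤ 4 H*a≤) ⟩
      (108 * q) ^ a * 4 ^ suc b             ∎
      where
      open ≤-Reasoning
      P : ℕ
      P = 2 ^ suc h
      squares : n ^ 2 ≤ 108 * q * 4 ^ suc h
      squares = begin
        n * (n * 1)                         ≡⟨ cong (n *_) (*-identityʳ n) ⟩
        n * n                               ≤⟨ *-mono-≤ n≤3mk n≤3mk ⟩
        3 * m * (2 * P) * (3 * m * (2 * P)) ≡⟨ e₁ m P ⟩
        36 * (m * m) * (P * P)              ≤⟨ *-monoˡ-≤ (P * P) (*-monoʳ-≤ 36 le) ⟩
        36 * (3 * q) * (P * P)              ≡⟨ cong₂ _*_ (sym (*-assoc 36 3 q)) (sym (^-distribʳ-* 2 2 (suc h))) ⟩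
        108 * q * 4 ^ suc h                 ∎
        where
        e₁ : ∀ m P → 3 * m * (2 * P) * (3 * m * (2 * P)) ≡ 36 * (m * m) * (P * P)
        e₁ = solve-∀

theorem1p1 : Σ ℕ λ C → 1 ≤ C ×
    (∀ (a b : ℕ) → 0 < a → 3 * a < 2 * suc b →
    Σ ℕ λ k → Σ ℕ λ n₀ → k ≤ n₀ ×
    (∀ (n : ℕ) → n₀ ≤ n → (A : RandAlg n) →
    EstimatesWHP k ((+ 5 / 3) Data.Rational.- (+ a / suc b)) A →
    Σ (Metric n) λ M → Σ (Fin (seeds A)) λ i →
    Data.Rational._<_ 0ℚ (prob A i) ×
    n ^ (2 * a) ≤ (C * numQueries (alg A i) M) ^ a * 4 ^ suc b))
theorem1p1 = 108 , s≤s z≤n , λ a b 0<a 3a<2b →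
  let open Parameters a b 0<a 3a<2b
      open Factor a b (<⇒≤ 3a<2b)
  in k , 2 * k , m≤m+n k _ , λ n 2k≤n A est →
    let i , 0<p , m²≤3q = Adversary.many-queries h n (m n 2k≤n) (fits n 2k≤n) (0<m n 2k≤n) A α 0≤α
          (gap (suc h) (2 ^ suc h) (m^n>0 2 (suc h)) <N*a) est
    in Planted.M₀ h n (m n 2k≤n) (fits n 2k≤n) , i , 0<p , query-bound n 2k≤n (numQueries (alg A i) _) m²≤3q
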